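{- For every integer $t \ge 2$ there exists a real constant $c_t > 0$ such that for every simple graph $G$ and every function $f : V(G) \to \mathbb{Z}_{\ge 2}$ with maximum value at most $t$, we have $$a_f(G) \le d + c_t d^{3/4} (\log d)^{1/2},$$ where $d = \max\{\Delta_f(G), a(G)\}$.
   Context: For a graph $G$ and a function $f : V(G) \to \mathbb{Z}_{\ge 2}$, a degree-$f$ forest of $G$ is a spanning subgraph that is a forest in which every vertex $v$ has degree at most $f(v)$. The degree-$f$ arboricity $a_f(G)$ is the minimum number of colors in an edge-coloring of $G$ in which every color class is a degree-$f$ forest. The arboricity $a(G)$ is the minimum number of colors in an edge-coloring of $G$ in which every color class is a forest. $\Delta_f(G) = \max_{v \in V(G)} \lceil d(v)/f(v) \rceil$, where $d(v)$ is the degree of $v$. -}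

module Defs where

open import Data.Nat using (ℕ; zero; suc; _+_; _*_; _∸_; _^_; _≤_; _<_; _⊔_)
open import Data.Nat.DivMod using (_/_)
open import Data.Bool using (Bool; true; false; _∧_; if_then_else_)
open import Data.Fin using (Fin; _≟_)
open import Data.List using (List; []; _∷_; length)
open import Data.List.Relation.Unary.Unique.Propositional using (Unique)
open import Data.Product using (Σ; _×_; ∃)
open import Relation.Binary.PropositionalEquality using (_≡_)
open import Relation.Nullary using (¬_; does)

record Graph (n : ℕ) : Set where
  field
    adj   : Fin n → Fin n → Bool
    sym   : ∀ u v → adj u v ≡ adj v u
    irrefl : ∀ v → adj v v ≡ false
open Graph public

sumFin : ∀ {n} → (Fin n → ℕ) → ℕ
sumFin {zero}  g = 0
sumFin {suc n} g = g Fin.zero + sumFin (λ i → g (Fin.suc i))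

maxFin : ∀ {n} → (Fin n → ℕ) → ℕ
maxFin {zero}  g = 0
maxFin {suc n} g = g Fin.zero ⊔ maxFin (λ i → g (Fin.suc i))

degreeIn : ∀ {n} → (Fin n → Fin n → Bool) → Fin n → ℕ
degreeIn a v = sumFin (λ u → if a v u then 1 else 0)

degree : ∀ {n} → Graph n → Fin n → ℕ
degree G = degreeIn (adj G)

-- Ceiling division ⌈ a / b ⌉ for b ≥ 1 (the divisor is written suc (b ∸ 1)
-- so that no NonZero instance is needed; it equals b whenever b ≥ 1).
ceilDiv : ℕ → ℕ → ℕ
ceilDiv a b = (a + (b ∸ 1)) / suc (b ∸ 1)

Δf : ∀ {n} → Graph n → (Fin n → ℕ) → ℕ
Δf G f = maxFin (λ v → ceilDiv (degree G v) (f v))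

data Path {n : ℕ} (a : Fin n → Fin n → Bool) : List (Fin n) → Set where
  single : ∀ v → Path a (v ∷ [])
  step   : ∀ u v vs → a u v ≡ true → Path a (v ∷ vs) → Path a (u ∷ v ∷ vs)

data Last {n : ℕ} : List (Fin n) → Fin n → Set where
  here  : ∀ v → Last (v ∷ []) v
  there : ∀ u vs w → Last vs w → Last (u ∷ vs) w

record Cycle {n : ℕ} (a : Fin n → Fin n → Bool) : Set where
  field
    verts    : List (Fin n)
    long     : 3 ≤ length verts
    distinct : Unique verts
    path     : Path a verts
    first    : Fin n
    last     : Fin n
    isFirst  : Σ (List (Fin n)) (λ rest → verts ≡ first ∷ rest)
    isLast   : Last verts last
    closing  : a last first ≡ true

IsForest : ∀ {n} → (Fin n → Fin n → Bool) → Set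
IsForest a = ¬ Cycle a

-- Edge colourings with k colours: a symmetric function on vertex pairs
-- (its values on non-edges are irrelevant).
record EdgeColouring {n : ℕ} (k : ℕ) : Set where
  field
    col    : Fin n → Fin n → Fin k
    colSym : ∀ u v → col u v ≡ col v u
open EdgeColouring public

colourClass : ∀ {n k} → Graph n → EdgeColouring {n} k → Fin k → Fin n → Fin n → Bool
colourClass G c i u v = adj G u v ∧ does (col c u v ≟ i)

ForestColourable : ∀ {n} → Graph n → ℕ → Set
ForestColourable {n} G k =
  ∃ λ (c : EdgeColouring {n} k) → ∀ i → IsForest (colourClass G c i)

FForestColourable : ∀ {n} → Graph n → (Fin n → ℕ) → ℕ → Set
FForestColourable {n} G f k =
  ∃ λ (c : EdgeColouring {n} k) → ∀ i →
    IsForest (colourClass G c i) ×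
    (∀ v → degreeIn (colourClass G c i) v ≤ f v)

IsArboricity : ∀ {n} → Graph n → ℕ → Set
IsArboricity G a = ForestColourable G a × (∀ k → ForestColourable G k → a ≤ k)

IsFArboricity : ∀ {n} → Graph n → (Fin n → ℕ) → ℕ → Set
IsFArboricity G f a = FForestColourable G f a × (∀ k → FForestColourable G f k → a ≤ k)

{-# OPTIONS --safe #-}
-- Root the forests of an optimal forest decomposition to orient G with out-degrees ≤ d, and push
-- in-degree along paths until moreover every in-degree is ≤ (f v − 1) d.  By the local lemma, colour
-- the vertices with p ≈ √d colours so that every vertex has at most S ≈ d/p out-neighbours, and at
-- most (f v − 1) S in-neighbours, of each colour.  The ordered pairs of distinct colours split into
-- p + 1 slots, each a union of directed paths (the zigzag decomposition); the arcs whose colour pair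
-- lies in a given slot form an acyclic digraph with out-degrees ≤ S and in-degrees ≤ (f v − 1) S.
-- The arcs inside colour classes form two more such digraphs (by vertex index).  Repeated halving
-- (S is a power of two) splits each of the p + 3 digraphs into S acyclic digraphs with out-degrees
-- ≤ 1 and in-degrees ≤ f v − 1, which are degree-f forests; and (p + 3) S is the required bound.
module Submission where

open import Defs hiding (sym)
open import Data.Bool using (Bool; true; false; _∧_; _∨_; not; if_then_else_)
open import Data.Bool.Properties using (∧-comm)
open import Data.Empty using (⊥; ⊥-elim)
open import Data.Fin using (Fin; zero; suc; _≟_; toℕ; splitAt; _↑ˡ_; _↑ʳ_; fromℕ<)
open import Data.Fin.Properties using (any?; splitAt-↑ˡ; splitAt-↑ʳ; fromℕ<-cong; toℕ-fromℕ<; toℕ<n; toℕ-injective)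
open import Data.List using (List; []; _∷_; length; allFin; tabulate)
open import Data.List.Membership.Propositional using (_∈_)
open import Data.List.Membership.Propositional.Properties using (∈-allFin)
import Data.List.Membership.DecPropositional as DecMembership
open import Data.List.Relation.Unary.All as All using (All; []; _∷_)
open import Data.List.Relation.Unary.AllPairs using ([]; _∷_)
open import Data.List.Relation.Unary.Any using (here; there)
open import Data.List.Relation.Unary.Unique.Propositional using (Unique)
open import Data.Nat using (ℕ; zero; suc; pred; _+_; _*_; _∸_; _^_; _≤_; _<_; _⊔_; z≤n; s≤s; _≤?_; _<?_; ∣_-_∣; >-nonZero)
open import Data.Nat.DivMod using (_/_; _%_; m≡m%n+[m/n]*n; [m+kn]%n≡m%n; m<n⇒m%n≡m; m%n<n; m/n≤m; m/n*n≤m)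
open import Data.Nat.Logarithm using (⌊log₂_⌋; ⌊log₂⌋-mono-≤; ⌊log₂[2^n]⌋≡n)
open import Data.Nat.Properties hiding (_≟_)
open import Data.Nat.Tactic.RingSolver using (solve-∀)
open import Data.Product using (Σ; ∃; _×_; _,_; proj₁; proj₂)
open import Data.Sum using (_⊎_; inj₁; inj₂; [_,_]′)
open import Data.Unit using (tt)
open import Data.Vec using (Vec; []; _∷_; lookup)
open import Function using (_∘_; flip; case_of_)
open import Relation.Binary.Definitions using (tri<; tri≈; tri>)
open import Relation.Binary.PropositionalEquality hiding ([_])
open import Relation.Nullary using (¬_; Dec; yes; no; does; contradiction)
open import Relation.Nullary.Decidable using (_×-dec_; ¬?; dec-true; dec-false)

-- Finite sums and reorientation

-- Halving the balanced orientation itself would, up to rounding, give the required degrees at once,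
-- but a class with out-degrees ≤ 1 can contain a directed cycle. The detour through vertex colours
-- buys acyclicity: in a slot each colour has at most one successor and one predecessor, so a vertex
-- keeps the spread bounds, and every arc lowers a potential of the colour. The price is (p + 3) S -
-- d. Rounding S to a power of two at the end could cost a factor 2, so S = r²Λ is built beforehand
-- from powers of two `r = 2 ^ j` and `Λ = 2 ^ λ′`, with Λ of order t log d, and p is fitted
-- afterwards. Concentration loses a factor 1 + O(1/r); taking r⁴Λ² ≈ d makes the loss O(d/r) =
-- O(d^(3/4) Λ^(1/2)). Probabilities are counts out of `p ^ n`, exponential moments are ratios of
-- integer powers, and the final estimate is compared in fourth powers, so everything stays in ℕ.

𝟙 : Bool → ℕ
𝟙 b = if b then 1 else 0

𝟙≤1 : ∀ b → 𝟙 b ≤ 1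
𝟙≤1 true = s≤s z≤n
𝟙≤1 false = z≤n

𝟙-∧ : ∀ a b → 𝟙 (a ∧ b) ≡ 𝟙 a * 𝟙 b
𝟙-∧ true true = refl
𝟙-∧ true false = refl
𝟙-∧ false b = refl

𝟙-mono : ∀ {a b} → (a ≡ true → b ≡ true) → 𝟙 a ≤ 𝟙 b
𝟙-mono {true} h rewrite h refl = ≤-refl
𝟙-mono {false} h = z≤n

∧-trueˡ : ∀ {a b} → a ∧ b ≡ true → a ≡ true
∧-trueˡ {true} _ = refl

∧-trueʳ : ∀ {a b} → a ∧ b ≡ true → b ≡ true
∧-trueʳ {true} h = h

∧-true : ∀ {a b} → a ≡ true → b ≡ true → a ∧ b ≡ true
∧-true refl refl = refl

not-true : ∀ {a} → not a ≡ true → a ≡ false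
not-true {false} _ = refl

true≢false : ∀ {b} → b ≡ true → b ≡ false → ⊥
true≢false refl ()

contra : ∀ {a b} → (a ≡ true → b ≡ true) → b ≡ false → a ≡ false
contra {false} _ _ = refl
contra {true} h e = ⊥-elim (true≢false (h refl) e)

does-true : ∀ {p} {P : Set p} (d : Dec P) → does d ≡ true → P
does-true (yes p) _ = p

eqᵇ : ∀ {n} → Fin n → Fin n → Bool
eqᵇ i j = does (i ≟ j)

eqᵇ-refl : ∀ {n} (i : Fin n) → eqᵇ i i ≡ true
eqᵇ-refl i = dec-true (i ≟ i) refl

sum-cong : ∀ {n} {g h : Fin n → ℕ} → (∀ i → g i ≡ h i) → sumFin g ≡ sumFin h
sum-cong {zero} e = refl
sum-cong {suc n} e = cong₂ _+_ (e zero) (sum-cong (e ∘ suc))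

sum-mono : ∀ {n} {g h : Fin n → ℕ} → (∀ i → g i ≤ h i) → sumFin g ≤ sumFin h
sum-mono {zero} e = z≤n
sum-mono {suc n} e = +-mono-≤ (e zero) (sum-mono (e ∘ suc))

sum-mono-< : ∀ {n} {g h : Fin n → ℕ} → (∀ i → g i ≤ h i) → ∀ i → g i < h i → sumFin g < sumFin h
sum-mono-< e zero l = +-mono-<-≤ l (sum-mono (e ∘ suc))
sum-mono-< e (suc i) l = +-mono-≤-< (e zero) (sum-mono-< (e ∘ suc) i l)

+-swap-middle : ∀ a b c d → (a + b) + (c + d) ≡ (a + c) + (b + d)
+-swap-middle = solve-∀

sum-+ : ∀ {n} (g h : Fin n → ℕ) → sumFin (λ i → g i + h i) ≡ sumFin g + sumFin h
sum-+ {zero} g h = refl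
sum-+ {suc n} g h rewrite sum-+ (g ∘ suc) (h ∘ suc) =
  +-swap-middle (g zero) (h zero) _ _

sum-*ˡ : ∀ {n} k (g : Fin n → ℕ) → sumFin (λ i → k * g i) ≡ k * sumFin g
sum-*ˡ {zero} k g = sym (*-zeroʳ k)
sum-*ˡ {suc n} k g rewrite sum-*ˡ k (g ∘ suc) = sym (*-distribˡ-+ k (g zero) _)

sum-*ʳ : ∀ {n} k (g : Fin n → ℕ) → sumFin (λ i → g i * k) ≡ sumFin g * k
sum-*ʳ k g = trans (sum-cong (λ i → *-comm (g i) k)) (trans (sum-*ˡ k g) (*-comm k _))

sum-const : ∀ n k → sumFin {n} (λ _ → k) ≡ n * k
sum-const zero k = refl
sum-const (suc n) k = cong (k +_) (sum-const n k)

sum-zero : ∀ {n} {g : Fin n → ℕ} → (∀ i → g i ≡ 0) → sumFin g ≡ 0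
sum-zero {n} e = trans (sum-cong e) (trans (sum-const n 0) (*-zeroʳ n))

sum-swap : ∀ {m n} (g : Fin m → Fin n → ℕ) →
  sumFin (λ i → sumFin (g i)) ≡ sumFin (λ j → sumFin (λ i → g i j))
sum-swap {zero} {n} g = sym (sum-zero {n} (λ _ → refl))
sum-swap {suc m} g =
  trans (cong (sumFin (g zero) +_) (sum-swap (g ∘ suc)))
        (sym (sum-+ (g zero) (λ j → sumFin (λ i → g (suc i) j))))

sum-++ : ∀ m {n} (g : Fin (m + n) → ℕ) →
  sumFin g ≡ sumFin (λ i → g (i ↑ˡ n)) + sumFin (λ j → g (m ↑ʳ j))
sum-++ zero g = refl
sum-++ (suc m) g = trans (cong (g zero +_) (sum-++ m (g ∘ suc))) (sym (+-assoc (g zero) _ _))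

sum-∋ : ∀ {n} (g : Fin n → ℕ) i → g i ≤ sumFin g
sum-∋ g zero = m≤m+n _ _
sum-∋ g (suc i) = ≤-trans (sum-∋ (g ∘ suc) i) (m≤n+m _ _)

sum-pos : ∀ {n} (g : Fin n → ℕ) → 0 < sumFin g → ∃ λ i → 0 < g i
sum-pos {suc n} g l with g zero in e
... | suc _ = zero , subst (0 <_) (sym e) (s≤s z≤n)
... | zero with sum-pos (g ∘ suc) l
...   | i , p = suc i , p

sum-δ : ∀ {n} (i : Fin n) → sumFin (λ j → 𝟙 (eqᵇ j i)) ≡ 1
sum-δ {suc n} zero = cong suc (sum-zero {n} (λ j → cong 𝟙 (dec-false (suc j ≟ zero) λ ())))
sum-δ {suc n} (suc i) = trans (sum-cong e) (sum-δ i)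
  where
  e : ∀ j → 𝟙 (eqᵇ (suc j) (suc i)) ≡ 𝟙 (eqᵇ j i)
  e j with j ≟ i
  ... | yes _ = refl
  ... | no _ = refl

sum-two : ∀ {n} (g : Fin n → ℕ) {i j} → i ≢ j → g i + g j ≤ sumFin g
sum-two g {zero} {zero} i≢j = contradiction refl i≢j
sum-two g {zero} {suc j} _ = +-monoʳ-≤ (g zero) (sum-∋ (g ∘ suc) j)
sum-two g {suc i} {zero} _ =
  subst (_≤ sumFin g) (+-comm (g zero) _) (+-monoʳ-≤ (g zero) (sum-∋ (g ∘ suc) i))
sum-two g {suc i} {suc j} i≢j =
  ≤-trans (sum-two (g ∘ suc) (i≢j ∘ cong suc)) (m≤n+m _ _)

count : ∀ {n} → (Fin n → Bool) → ℕ
count R = sumFin (λ i → 𝟙 (R i))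

count≤ : ∀ {n} (R : Fin n → Bool) → count R ≤ n
count≤ {n} R = subst (count R ≤_) (trans (sum-const n 1) (*-identityʳ n)) (sum-mono (λ i → 𝟙≤1 (R i)))

insert : ∀ {n} → (Fin n → Bool) → Fin n → Fin n → Bool
insert R x i = if eqᵇ i x then true else R i

insert-self : ∀ {n} (R : Fin n → Bool) x → insert R x x ≡ true
insert-self R x rewrite eqᵇ-refl x = refl

insert-⊇ : ∀ {n} (R : Fin n → Bool) x {i} → R i ≡ true → insert R x i ≡ true
insert-⊇ R x {i} h with i ≟ x
... | yes _ = refl
... | no _ = h

insert-∈ : ∀ {n} (R : Fin n → Bool) x {i} → insert R x i ≡ true → i ≡ x ⊎ R i ≡ true
insert-∈ R x {i} h with i ≟ x
... | yes e = inj₁ e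
... | no _ = inj₂ h

count-insert : ∀ {n} (R : Fin n → Bool) x → R x ≡ false → count R < count (insert R x)
count-insert R x e = sum-mono-< (λ i → 𝟙-mono (insert-⊇ R x)) x
  (subst₂ _<_ (cong 𝟙 (sym e)) (cong 𝟙 (sym (insert-self R x))) (s≤s z≤n))

-- Orientations and path reversal

Digraph : ℕ → Set
Digraph n = Fin n → Fin n → Bool

out in′ : ∀ {n} → Digraph n → Fin n → ℕ
out A = degreeIn A
in′ A = degreeIn (flip A)

-- An equation between indicators instead of a disjunction: summing it gives the degree formula, and
-- `𝟙 ≤ 1` on the left forces each edge to carry a single direction.
record Orients {n} (a o : Digraph n) : Set where
  constructor orients
  field once : ∀ u v → 𝟙 (a u v) ≡ 𝟙 (o u v) + 𝟙 (o v u)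
open Orients public

Orients-flip : ∀ {n} {a o : Digraph n} → Orients a o → Orients a (flip o)
Orients-flip {o = o} s .once u v = trans (s .once u v) (+-comm (𝟙 (o u v)) _)

deg-orient : ∀ {n} {a o : Digraph n} → Orients a o → ∀ v → degreeIn a v ≡ out o v + in′ o v
deg-orient {o = o} s v = trans (sum-cong (s .once v)) (sum-+ (λ u → 𝟙 (o v u)) (λ u → 𝟙 (o u v)))

orient-antisym : ∀ {n} {a o : Digraph n} → Orients a o → ∀ {u v} → o u v ≡ true → o v u ≡ false
orient-antisym {a = a} {o} s {u} {v} e with o v u in e'
... | false = refl
... | true = contradiction (subst (_≤ 1) (trans (s .once u v) (cong₂ (λ x y → 𝟙 x + 𝟙 y) e e')) (𝟙≤1 (a u v)))
                           λ { (s≤s ()) }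

flipArc : ∀ {n} → Digraph n → Fin n → Fin n → Digraph n
flipArc o x y a b =
  if eqᵇ a x ∧ eqᵇ b y then false else if eqᵇ a y ∧ eqᵇ b x then true else o a b

flipArc-other : ∀ {n} {o : Digraph n} {x y a b} → ¬ (a ≡ x × b ≡ y) → ¬ (a ≡ y × b ≡ x) →
  flipArc o x y a b ≡ o a b
flipArc-other {x = x} {y} {a} {b} ne ne' with a ≟ x | b ≟ y | a ≟ y | b ≟ x
... | yes p | yes q | _ | _ = contradiction (p , q) ne
... | yes _ | no _ | yes r | yes t = contradiction (r , t) ne'
... | yes _ | no _ | yes _ | no _ = refl
... | yes _ | no _ | no _ | _ = refl
... | no _ | _ | yes r | yes t = contradiction (r , t) ne'
... | no _ | _ | yes _ | no _ = refl
... | no _ | _ | no _ | _ = refl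

flipArc-spec : ∀ {n} {o : Digraph n} {x y} → o x y ≡ true → o y x ≡ false → ∀ a b →
  𝟙 (flipArc o x y a b) + 𝟙 (eqᵇ a x) * 𝟙 (eqᵇ b y) ≡ 𝟙 (o a b) + 𝟙 (eqᵇ a y) * 𝟙 (eqᵇ b x)
flipArc-spec {o = o} {x} {y} p q a b with a ≟ x | b ≟ y | a ≟ y | b ≟ x
... | yes refl | yes refl | yes refl | yes _ = ⊥-elim (true≢false p q)
... | yes refl | yes refl | yes refl | no ¬r = contradiction refl ¬r
... | yes refl | yes refl | no _ | _ rewrite p = refl
... | yes refl | no ¬r | yes refl | yes refl = contradiction refl ¬r
... | yes refl | no _ | yes refl | no _ = refl
... | yes refl | no _ | no _ | _ = refl
... | no _ | _ | yes refl | yes refl rewrite q = refl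
... | no _ | _ | yes refl | no _ = refl
... | no _ | _ | no _ | _ = refl

cancel-mid : ∀ {a b c d e f} → a + b ≡ c + d → c + e ≡ f + b → a + e ≡ f + d
cancel-mid {a} {b} {c} {d} {e} {f} p q = +-cancelˡ-≡ (b + c) _ _ (begin
  (b + c) + (a + e) ≡⟨ l₁ b c a e ⟩
  (a + b) + (c + e) ≡⟨ cong₂ _+_ p q ⟩
  (c + d) + (f + b) ≡⟨ l₂ c d f b ⟩
  (b + c) + (f + d) ∎)
  where
  open ≡-Reasoning
  l₁ : ∀ b c a e → (b + c) + (a + e) ≡ (a + b) + (c + e)
  l₁ = solve-∀
  l₂ : ∀ c d f b → (c + d) + (f + b) ≡ (b + c) + (f + d)
  l₂ = solve-∀

flipArc-orients : ∀ {n} {a o : Digraph n} {x y} → Orients a o → o x y ≡ true →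
  Orients a (flipArc o x y)
flipArc-orients {a = a} {o} {x} {y} s p .once u v =
  trans (s .once u v) (sym (+-cancelʳ-≡ (Bxy + Byx) _ _ (begin
    (𝟙 (o' u v) + 𝟙 (o' v u)) + (Bxy + Byx) ≡⟨ +-swap-middle (𝟙 (o' u v)) (𝟙 (o' v u)) Bxy Byx ⟩
    (𝟙 (o' u v) + Bxy) + (𝟙 (o' v u) + Byx) ≡⟨ cong₂ _+_ (spec u v) (trans (cong (𝟙 (o' v u) +_) (*-comm (𝟙 (eqᵇ u y)) _)) (trans (spec v u) (cong (𝟙 (o v u) +_) (*-comm (𝟙 (eqᵇ v y)) _)))) ⟩
    (𝟙 (o u v) + Byx) + (𝟙 (o v u) + Bxy) ≡⟨ l (𝟙 (o u v)) Byx (𝟙 (o v u)) Bxy ⟩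
    (𝟙 (o u v) + 𝟙 (o v u)) + (Bxy + Byx) ∎)))
  where
  open ≡-Reasoning
  o' = flipArc o x y
  Bxy = 𝟙 (eqᵇ u x) * 𝟙 (eqᵇ v y)
  Byx = 𝟙 (eqᵇ u y) * 𝟙 (eqᵇ v x)
  spec = flipArc-spec {o = o} p (orient-antisym s p)
  l : ∀ p q r s → (p + q) + (r + s) ≡ (p + r) + (s + q)
  l = solve-∀

-- One unit of in-degree passes from `v` to `w`. The additive form avoids truncated subtraction,
-- lets moves compose by cancellation, and for `v = w` is the trivial move that starts the search.
Moves : ∀ {n} → Digraph n → Digraph n → Fin n → Fin n → Set
Moves o o' v w = ∀ u → in′ o' u + 𝟙 (eqᵇ u v) ≡ in′ o u + 𝟙 (eqᵇ u w)

flipArc-moves : ∀ {n} {o : Digraph n} {x y} → o x y ≡ true → o y x ≡ false →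
  Moves o (flipArc o x y) y x
flipArc-moves {o = o} {x} {y} p q u = begin
  in′ o' u + 𝟙 (eqᵇ u y)                          ≡⟨ cong (in′ o' u +_) (sym (one x (𝟙 (eqᵇ u y)))) ⟩
  in′ o' u + sumFin (λ a → 𝟙 (eqᵇ a x) * 𝟙 (eqᵇ u y)) ≡⟨ sym (sum-+ (λ a → 𝟙 (o' a u)) _) ⟩
  sumFin (λ a → 𝟙 (o' a u) + 𝟙 (eqᵇ a x) * 𝟙 (eqᵇ u y)) ≡⟨ sum-cong (λ a → flipArc-spec {o = o} p q a u) ⟩
  sumFin (λ a → 𝟙 (o a u) + 𝟙 (eqᵇ a y) * 𝟙 (eqᵇ u x)) ≡⟨ sum-+ (λ a → 𝟙 (o a u)) _ ⟩
  in′ o u + sumFin (λ a → 𝟙 (eqᵇ a y) * 𝟙 (eqᵇ u x)) ≡⟨ cong (in′ o u +_) (one y (𝟙 (eqᵇ u x))) ⟩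
  in′ o u + 𝟙 (eqᵇ u x) ∎
  where
  open ≡-Reasoning
  o' = flipArc o x y
  one : ∀ z k → sumFin (λ a → 𝟙 (eqᵇ a z) * k) ≡ k
  one z k = trans (sum-*ʳ k (λ a → 𝟙 (eqᵇ a z))) (trans (cong (_* k) (sum-δ z)) (*-identityˡ k))

-- Ordered pairs are counted, so a symmetric relation has each edge inside `R` counted twice; hence
-- the factor 2 in the sparsity hypotheses.
inside : ∀ {n} → Digraph n → (Fin n → Bool) → ℕ
inside a R = sumFin (λ w → sumFin (λ u → 𝟙 (R u ∧ R w) * 𝟙 (a u w)))

inside-orient : ∀ {n} {a o : Digraph n} (R : Fin n → Bool) → Orients a o →
  inside a R ≡ 2 * inside o R
inside-orient {a = a} {o} R s = begin
  inside a R ≡⟨ sum-cong (λ w → trans (sum-cong (λ u → trans (cong (𝟙 (R u ∧ R w) *_) (s .once u w)) (*-distribˡ-+ (𝟙 (R u ∧ R w)) (𝟙 (o u w)) (𝟙 (o w u))))) (sum-+ (F w) (B w))) ⟩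
  sumFin (λ w → sumFin (F w) + sumFin (B w)) ≡⟨ sum-+ (λ w → sumFin (F w)) (λ w → sumFin (B w)) ⟩
  inside o R + sumFin (λ w → sumFin (B w)) ≡⟨ cong (inside o R +_) (trans (sum-swap B) (sum-cong (λ u → sum-cong (λ w → cong (λ b → 𝟙 b * 𝟙 (o w u)) (∧-comm (R u) (R w)))))) ⟩
  inside o R + inside o R ≡⟨ cong (inside o R +_) (sym (+-identityʳ _)) ⟩
  2 * inside o R ∎
  where
  open ≡-Reasoning
  F B : Fin _ → Fin _ → ℕ
  F w u = 𝟙 (R u ∧ R w) * 𝟙 (o u w)
  B w u = 𝟙 (R u ∧ R w) * 𝟙 (o w u)

module Augment {n} (a o : Digraph n) (s : Orients a o) (α : Fin n → ℕ)
  (sparse : ∀ R → inside a R ≤ 2 * sumFin (λ w → 𝟙 (R w) * α w))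
  (v : Fin n) (over : α v < in′ o v) where

  -- Some path from r to v inside R has been reversed; only the effect of the reversal is recorded.
  Good : (Fin n → Bool) → Fin n → Set
  Good R r = Σ (Digraph n) λ o' → Orients a o' × Moves o o' v r ×
    (∀ x y → R x ∧ R y ≡ false → o' x y ≡ o x y)

  Result : Set
  Result = Σ (Digraph n) λ o' → Orients a o' × (∃ λ w → in′ o w < α w × Moves o o' v w)

  -- All arcs into R come from R, so the in-degrees in R count the arcs inside R.
  closed-impossible : ∀ (R : Fin n → Bool) → R v ≡ true → (∀ r → R r ≡ true → α r ≤ in′ o r) →
    (∀ x y → R y ≡ true → o x y ≡ true → R x ≡ true) → ⊥
  closed-impossible R Rv full closed = <⇒≱ excess (*-cancelˡ-≤ 2 (begin
    2 * inside o R ≡⟨ inside-orient R s ⟨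
    inside a R ≤⟨ sparse R ⟩
    2 * sumFin (λ w → 𝟙 (R w) * α w) ∎))
    where
    open ≤-Reasoning
    pt : ∀ (w u : Fin n) → 𝟙 (R w) * 𝟙 (o u w) ≤ 𝟙 (R u ∧ R w) * 𝟙 (o u w)
    pt w u with R w in ew | o u w in eo
    ... | false | _ = z≤n
    ... | true | false = z≤n
    ... | true | true rewrite closed u w ew eo = ≤-refl
    ins : ∀ w → 𝟙 (R w) * in′ o w ≤ sumFin (λ u → 𝟙 (R u ∧ R w) * 𝟙 (o u w))
    ins w = ≤-trans (≤-reflexive (sym (sum-*ˡ (𝟙 (R w)) (λ u → 𝟙 (o u w))))) (sum-mono (pt w))
    le : ∀ w → 𝟙 (R w) * α w ≤ 𝟙 (R w) * in′ o w
    le w with R w in e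
    ... | true = *-monoʳ-≤ 1 (full w e)
    ... | false = z≤n
    lt : 𝟙 (R v) * α v < 𝟙 (R v) * in′ o v
    lt rewrite Rv = *-monoʳ-< 1 over
    excess : sumFin (λ w → 𝟙 (R w) * α w) < inside o R
    excess = <-≤-trans (sum-mono-< le v lt) (sum-mono ins)

  -- `R` collects vertices from which `v` can be reached, all with in-degree at least their cap. If
  -- an arc enters `R` from outside, its tail `x` either is below its cap and ends the search, or
  -- joins `R`. If none enters, `R` is closed and sparsity fails. `count R` grows each round, so the
  -- fuel cannot run out.
  search : ∀ k (R : Fin n → Bool) → n < k + count R → R v ≡ true → (∀ r → R r ≡ true → α r ≤ in′ o r) →
    (∀ r → R r ≡ true → Good R r) → Result
  search zero R l _ _ _ = ⊥-elim (<⇒≱ l (count≤ R))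
  search (suc k) R l Rv full good
    with any? (λ x → any? (λ y → (R x Data.Bool.≟ false) ×-dec (R y Data.Bool.≟ true) ×-dec (o x y Data.Bool.≟ true)))
  ... | no none = ⊥-elim (closed-impossible R Rv full closed)
    where
    closed : ∀ x y → R y ≡ true → o x y ≡ true → R x ≡ true
    closed x y Ry oxy with R x in e
    ... | true = refl
    ... | false = contradiction (x , y , e , Ry , oxy) none
  ... | yes (x , y , Rx , Ry , oxy) with good y Ry
  ... | o' , s' , mv , agree = continue (in′ o x <? α x)
    where
    -- `x` lies outside `R`, and the reversal recorded for `y` touches only pairs inside `R`, so the
    -- arc found in `o` is still present in `o'`.
    o'xy : o' x y ≡ true
    o'xy = trans (agree x y (cong (_∧ R y) Rx)) oxy
    o'' = flipArc o' x y
    s'' = flipArc-orients s' o'xy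
    mv'' : Moves o o'' v x
    mv'' u = cancel-mid {in′ o'' u} (flipArc-moves {o = o'} o'xy (orient-antisym s' o'xy) u) (mv u)
    R' = insert R x
    off : ∀ p q → R' p ∧ R' q ≡ false → R p ∧ R q ≡ false
    off p q = contra λ t → ∧-true (insert-⊇ R x (∧-trueˡ t)) (insert-⊇ R x (∧-trueʳ {R p} t))
    agree'' : ∀ p q → R' p ∧ R' q ≡ false → o'' p q ≡ o p q
    agree'' p q h = trans
      (flipArc-other {o = o'} (λ { (refl , refl) → true≢false (∧-true (insert-self R x) (insert-⊇ R x Ry)) h })
                              (λ { (refl , refl) → true≢false (∧-true (insert-⊇ R x Ry) (insert-self R x)) h }))
      (agree p q (off p q h))
    continue : Dec (in′ o x < α x) → Result
    continue (yes lt) = o'' , s'' , x , lt , mv''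
    continue (no ¬lt) = search k R'
      (≤-trans l (≤-trans (≤-reflexive (sym (+-suc k _))) (+-monoʳ-≤ k (count-insert R x Rx))))
      (insert-⊇ R x Rv) full' good'
      where
      full' : ∀ r → R' r ≡ true → α r ≤ in′ o r
      full' r h with insert-∈ R x h
      ... | inj₁ refl = ≮⇒≥ ¬lt
      ... | inj₂ h' = full r h'
      good' : ∀ r → R' r ≡ true → Good R' r
      good' r h with insert-∈ R x h
      ... | inj₁ refl = o'' , s'' , mv'' , agree''
      ... | inj₂ h' with good r h'
      ...   | p , t , m , g = p , t , m , λ b c z → g b c (off b c z)

  augment : Result
  augment = search n R₀ (s≤s-lemma) (eqᵇ-refl v)
    (λ r h → case does-true (r ≟ v) h of λ { refl → <⇒≤ over })
    (λ r h → case does-true (r ≟ v) h of λ { refl → o , s , (λ u → refl) , λ _ _ _ → refl })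
    where
    R₀ : Fin n → Bool
    R₀ r = eqᵇ r v
    s≤s-lemma : n < n + count R₀
    s≤s-lemma rewrite sum-δ v = ≤-reflexive (+-comm 1 n)

-- Induction on the total excess over the caps `α`. The out-degree bounds survive a reversal: at `w`
-- the out-degree drops, and at `v` the in-degree is still at least `α v`, so the degree bound
-- leaves at most `β v` for the out-arcs.
reorient : ∀ {n} (a : Digraph n) (α β : Fin n → ℕ) →
  (∀ R → inside a R ≤ 2 * sumFin (λ w → 𝟙 (R w) * α w)) →
  (∀ v → degreeIn a v ≤ α v + β v) →
  ∀ k o → Orients a o → (∀ v → out o v ≤ β v) → sumFin (λ v → in′ o v ∸ α v) ≤ k →
  Σ (Digraph n) λ o' → Orients a o' × (∀ v → in′ o' v ≤ α v) × (∀ v → out o' v ≤ β v)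
reorient a α β sparse deg k o s out≤ ex with any? (λ v → α v <? in′ o v)
... | no none = o , s , (λ v → ≮⇒≥ (λ l → none (v , l))) , out≤
reorient a α β sparse deg zero o s out≤ ex | yes (v , over) =
  ⊥-elim (<⇒≱ (m<n⇒0<n∸m over) (≤-trans (sum-∋ (λ v → in′ o v ∸ α v) v) ex))
reorient a α β sparse deg (suc k) o s out≤ ex | yes (v , over)
  with Augment.augment a o s α sparse v over
... | o' , s' , w , under , mv = reorient a α β sparse deg k o' s' out' (≤-pred (<-≤-trans less ex))
  where
  v≢w : v ≢ w
  v≢w refl = <-asym over under
  cases : ∀ u → (u ≡ v × suc (in′ o' u) ≡ in′ o u) ⊎ (u ≡ w × in′ o' u ≡ suc (in′ o u)) ⊎ in′ o' u ≡ in′ o u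
  cases u with u ≟ v | u ≟ w | mv u
  ... | yes refl | yes refl | _ = contradiction refl v≢w
  ... | yes refl | no _ | e = inj₁ (refl , trans (+-comm 1 _) (trans e (+-identityʳ _)))
  ... | no _ | yes refl | e = inj₂ (inj₁ (refl , trans (sym (+-identityʳ _)) (trans e (+-comm _ 1))))
  ... | no _ | no _ | e = inj₂ (inj₂ (+-cancelʳ-≡ 0 _ _ e))
  drop : ∀ u → in′ o' u ∸ α u ≤ in′ o u ∸ α u
  drop u with cases u
  ... | inj₁ (_ , e) = ∸-monoˡ-≤ (α u) (≤-trans (n≤1+n _) (≤-reflexive e))
  ... | inj₂ (inj₁ (refl , e)) = ≤-trans (≤-reflexive (m≤n⇒m∸n≡0 (≤-trans (≤-reflexive e) under))) z≤n
  ... | inj₂ (inj₂ e) = ≤-reflexive (cong (_∸ α u) e)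
  dropv : in′ o' v ∸ α v < in′ o v ∸ α v
  dropv with cases v
  ... | inj₁ (_ , e) = ∸-monoˡ-< (≤-reflexive e) (≤-pred (≤-trans over (≤-reflexive (sym e))))
  ... | inj₂ (inj₁ (e , _)) = contradiction e v≢w
  ... | inj₂ (inj₂ e) with mv v
  ...   | e' rewrite eqᵇ-refl v | dec-false (v ≟ w) v≢w | e =
            contradiction (+-cancelˡ-≡ (in′ o v) 1 0 e') λ ()
  less : sumFin (λ v → in′ o' v ∸ α v) < sumFin (λ v → in′ o v ∸ α v)
  less = sum-mono-< drop v dropv
  cmp : ∀ u → in′ o u ≤ in′ o' u → out o' u ≤ β u
  cmp u h = ≤-trans (+-cancelʳ-≤ (in′ o u) _ _ (begin
    out o' u + in′ o u ≤⟨ +-monoʳ-≤ (out o' u) h ⟩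
    out o' u + in′ o' u ≡⟨ deg-orient s' u ⟨
    degreeIn a u ≡⟨ deg-orient s u ⟩
    out o u + in′ o u ∎)) (out≤ u)
    where open ≤-Reasoning
  out' : ∀ u → out o' u ≤ β u
  out' u with cases u
  ... | inj₁ (refl , e) = +-cancelˡ-≤ (α u) _ _ (begin
    α u + out o' u ≤⟨ +-monoˡ-≤ (out o' u) (≤-pred (≤-trans over (≤-reflexive (sym e)))) ⟩
    in′ o' u + out o' u ≡⟨ +-comm (in′ o' u) _ ⟩
    out o' u + in′ o' u ≡⟨ deg-orient s' u ⟨
    degreeIn a u ≤⟨ deg u ⟩
    α u + β u ∎)
    where open ≤-Reasoning
  ... | inj₂ (inj₁ (_ , e)) = cmp u (≤-trans (n≤1+n _) (≤-reflexive (sym e)))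
  ... | inj₂ (inj₂ e) = cmp u (≤-reflexive (sym e))

reorientation : ∀ {n} (a : Digraph n) (α β : Fin n → ℕ) →
  (∀ R → inside a R ≤ 2 * sumFin (λ w → 𝟙 (R w) * α w)) →
  (∀ v → degreeIn a v ≤ α v + β v) →
  ∀ o → Orients a o → (∀ v → out o v ≤ β v) →
  Σ (Digraph n) λ o' → Orients a o' × (∀ v → in′ o' v ≤ α v) × (∀ v → out o' v ≤ β v)
reorientation a α β sparse deg o s out≤ = reorient a α β sparse deg _ o s out≤ ≤-refl

-- Euler-type halving and decompositions into branchings

inside-≤-in : ∀ {n} (a : Digraph n) R → inside a R ≤ sumFin (λ w → 𝟙 (R w) * in′ a w)
inside-≤-in a R = sum-mono λ w →
  ≤-trans (sum-mono (λ u → *-monoˡ-≤ (𝟙 (a u w)) (𝟙-mono (∧-trueʳ {R u}))))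
          (≤-reflexive (sum-*ˡ (𝟙 (R w)) (λ u → 𝟙 (a u w))))

-- Arcs become edges of the bipartite double cover, with an out-copy and an in-copy of each vertex.
-- An orientation in which in- and out-degrees are at most half of the even degree bound splits the
-- arcs in two: edges directed left to right against edges directed right to left.
module Halve {n} (A : Digraph n) (r s : Fin n → ℕ)
  (out≤ : ∀ u → out A u ≤ 2 * r u) (in≤ : ∀ v → in′ A v ≤ 2 * s v) where

  cross arcs : Fin n ⊎ Fin n → Fin n ⊎ Fin n → Bool
  arcs (inj₁ u) (inj₂ v) = A u v
  arcs _ _ = false
  cross (inj₁ u) (inj₂ v) = A u v
  cross (inj₂ v) (inj₁ u) = A u v
  cross _ _ = false

  a o : Digraph (n + n)
  a x y = cross (splitAt n x) (splitAt n y)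
  o x y = arcs (splitAt n x) (splitAt n y)

  c : Fin (n + n) → ℕ
  c x = [ r , s ]′ (splitAt n x)

  orients₀ : Orients a o
  orients₀ .once x y with splitAt n x | splitAt n y
  ... | inj₁ _ | inj₁ _ = refl
  ... | inj₁ _ | inj₂ _ = sym (+-identityʳ _)
  ... | inj₂ _ | inj₁ _ = refl
  ... | inj₂ _ | inj₂ _ = refl

  cross-sym : ∀ p q → cross p q ≡ cross q p
  cross-sym (inj₁ _) (inj₁ _) = refl
  cross-sym (inj₁ _) (inj₂ _) = refl
  cross-sym (inj₂ _) (inj₁ _) = refl
  cross-sym (inj₂ _) (inj₂ _) = refl

  sum-sides : (g : Fin n ⊎ Fin n → ℕ) →
    sumFin (λ y → g (splitAt n y)) ≡ sumFin (λ i → g (inj₁ i)) + sumFin (λ j → g (inj₂ j))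
  sum-sides g = trans (sum-++ n (λ y → g (splitAt n y)))
    (cong₂ _+_ (sum-cong (λ i → cong g (splitAt-↑ˡ n i n))) (sum-cong (λ j → cong g (splitAt-↑ʳ n n j))))

  deg≤ : ∀ x → degreeIn a x ≤ 2 * c x
  deg≤ x with splitAt n x
  ... | inj₁ u = ≤-trans (≤-reflexive (trans (sum-sides (λ q → 𝟙 (cross (inj₁ u) q))) (cong (_+ out A u) (sum-zero {n} (λ _ → refl))))) (out≤ u)
  ... | inj₂ v = ≤-trans (≤-reflexive (trans (sum-sides (λ q → 𝟙 (cross (inj₂ v) q))) (trans (cong (in′ A v +_) (sum-zero {n} (λ _ → refl))) (+-identityʳ _)))) (in≤ v)

  sparse : ∀ R → inside a R ≤ 2 * sumFin (λ w → 𝟙 (R w) * c w)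
  sparse R = begin
    inside a R ≤⟨ inside-≤-in a R ⟩
    sumFin (λ w → 𝟙 (R w) * in′ a w) ≤⟨ sum-mono (λ w → *-monoʳ-≤ (𝟙 (R w)) (≤-trans (≤-reflexive (sum-cong (λ u → cong 𝟙 (cross-sym (splitAt n u) (splitAt n w))))) (deg≤ w))) ⟩
    sumFin (λ w → 𝟙 (R w) * (2 * c w)) ≡⟨ sum-cong (λ w → l (𝟙 (R w)) (c w)) ⟩
    sumFin (λ w → 2 * (𝟙 (R w) * c w)) ≡⟨ sum-*ˡ 2 (λ w → 𝟙 (R w) * c w) ⟩
    2 * sumFin (λ w → 𝟙 (R w) * c w) ∎
    where
    open ≤-Reasoning
    l : ∀ x y → x * (2 * y) ≡ 2 * (x * y)
    l = solve-∀

  Balanced : Digraph (n + n) → Set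
  Balanced o' = Orients a o' × (∀ x → in′ o' x ≤ c x) × (∀ x → out o' x ≤ c x)

  out₀≤ : ∀ x → out o x ≤ 2 * c x
  out₀≤ x = begin
    out o x ≤⟨ m≤m+n _ (in′ o x) ⟩
    out o x + in′ o x ≡⟨ deg-orient orients₀ x ⟨
    degreeIn a x ≤⟨ deg≤ x ⟩
    2 * c x ∎
    where open ≤-Reasoning

  deg≤′ : ∀ x → degreeIn a x ≤ c x + c x
  deg≤′ x = ≤-trans (deg≤ x) (≤-reflexive (cong (c x +_) (+-identityʳ _)))

  balanced : Σ (Digraph (n + n)) Balanced
  balanced = finish (reorientation a c (λ x → 2 * c x) sparse (λ x → ≤-trans (deg≤ x) (m≤n+m _ (c x))) o orients₀ out₀≤)
    where
    finish : (Σ (Digraph (n + n)) λ o' → Orients a o' × (∀ x → in′ o' x ≤ c x) × (∀ x → out o' x ≤ 2 * c x)) →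
      Σ (Digraph (n + n)) Balanced
    -- The first pass caps in-degrees by `c`. Reversing all arcs turns this into a cap on
    -- out-degrees, which the second pass preserves while capping in-degrees.
    finish (o₁ , s₁ , in₁ , _) = reorientation a c c sparse deg≤′ (flip o₁) (Orients-flip s₁) in₁

  Halving : Digraph n → Set
  Halving χ =
    (∀ u → out (λ u v → A u v ∧ χ u v) u ≤ r u × out (λ u v → A u v ∧ not (χ u v)) u ≤ r u) ×
    (∀ v → in′ (λ u v → A u v ∧ χ u v) v ≤ s v × in′ (λ u v → A u v ∧ not (χ u v)) v ≤ s v)

  module _ (o' : Digraph (n + n)) (bal : Balanced o') where
    χ : Digraph n
    χ u v = o' (u ↑ˡ n) (n ↑ʳ v)

    capˡ : ∀ u {k} → k ≤ c (u ↑ˡ n) → k ≤ r u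
    capˡ u l rewrite splitAt-↑ˡ n u n = l

    capʳ : ∀ v {k} → k ≤ c (n ↑ʳ v) → k ≤ s v
    capʳ v l rewrite splitAt-↑ʳ n n v = l

    rest : ∀ u v → 𝟙 (A u v ∧ not (χ u v)) ≤ 𝟙 (o' (n ↑ʳ v) (u ↑ˡ n))
    rest u v with proj₁ bal .once (u ↑ˡ n) (n ↑ʳ v)
    ... | e rewrite splitAt-↑ˡ n u n | splitAt-↑ʳ n n v with A u v | o' (u ↑ˡ n) (n ↑ʳ v)
    ...   | false | _ = z≤n
    ...   | true | true = z≤n
    ...   | true | false = ≤-reflexive e

    left : (g : Fin (n + n) → ℕ) → sumFin (λ i → g (i ↑ˡ n)) ≤ sumFin g
    left g = ≤-trans (m≤m+n _ _) (≤-reflexive (sym (sum-++ n g)))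

    right : (g : Fin (n + n) → ℕ) → sumFin (λ i → g (n ↑ʳ i)) ≤ sumFin g
    right g = ≤-trans (m≤n+m _ (sumFin (λ i → g (i ↑ˡ n)))) (≤-reflexive (sym (sum-++ n g)))

    kept : ∀ u v → 𝟙 (A u v ∧ χ u v) ≤ 𝟙 (χ u v)
    kept u v = 𝟙-mono (∧-trueʳ {A u v})

    halving : Halving χ
    halving .proj₁ u .proj₁ = capˡ u (begin
      sumFin (λ v → 𝟙 (A u v ∧ χ u v)) ≤⟨ sum-mono (kept u) ⟩
      sumFin (λ v → 𝟙 (χ u v)) ≤⟨ right (λ y → 𝟙 (o' (u ↑ˡ n) y)) ⟩
      out o' (u ↑ˡ n) ≤⟨ proj₂ (proj₂ bal) (u ↑ˡ n) ⟩
      c (u ↑ˡ n) ∎)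
      where open ≤-Reasoning
    halving .proj₁ u .proj₂ = capˡ u (begin
      sumFin (λ v → 𝟙 (A u v ∧ not (χ u v))) ≤⟨ sum-mono (rest u) ⟩
      sumFin (λ v → 𝟙 (o' (n ↑ʳ v) (u ↑ˡ n))) ≤⟨ right (λ y → 𝟙 (o' y (u ↑ˡ n))) ⟩
      in′ o' (u ↑ˡ n) ≤⟨ proj₁ (proj₂ bal) (u ↑ˡ n) ⟩
      c (u ↑ˡ n) ∎)
      where open ≤-Reasoning
    halving .proj₂ v .proj₁ = capʳ v (begin
      sumFin (λ u → 𝟙 (A u v ∧ χ u v)) ≤⟨ sum-mono (λ u → kept u v) ⟩
      sumFin (λ u → 𝟙 (χ u v)) ≤⟨ left (λ y → 𝟙 (o' y (n ↑ʳ v))) ⟩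
      in′ o' (n ↑ʳ v) ≤⟨ proj₁ (proj₂ bal) (n ↑ʳ v) ⟩
      c (n ↑ʳ v) ∎)
      where open ≤-Reasoning
    halving .proj₂ v .proj₂ = capʳ v (begin
      sumFin (λ u → 𝟙 (A u v ∧ not (χ u v))) ≤⟨ sum-mono (λ u → rest u v) ⟩
      sumFin (λ u → 𝟙 (o' (n ↑ʳ v) (u ↑ˡ n))) ≤⟨ left (λ y → 𝟙 (o' (n ↑ʳ v) y)) ⟩
      out o' (n ↑ʳ v) ≤⟨ proj₂ (proj₂ bal) (n ↑ʳ v) ⟩
      c (n ↑ʳ v) ∎)
      where open ≤-Reasoning

  halve : Σ (Digraph n) Halving
  halve = χ (proj₁ balanced) (proj₂ balanced) , halving (proj₁ balanced) (proj₂ balanced)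

_⊆_ : ∀ {n} → Digraph n → Digraph n → Set
B ⊆ A = ∀ u v → B u v ≡ true → A u v ≡ true

out-mono : ∀ {n} {A B : Digraph n} → B ⊆ A → ∀ v → out B v ≤ out A v
out-mono s v = sum-mono (λ u → 𝟙-mono (s v u))

in-mono : ∀ {n} {A B : Digraph n} → B ⊆ A → ∀ v → in′ B v ≤ in′ A v
in-mono s v = sum-mono (λ u → 𝟙-mono (s u v))

Descends : ∀ {n} → (Fin n → ℕ) → Digraph n → Set
Descends h A = ∀ u v → A u v ≡ true → h v < h u

-- `height` certifies acyclicity in a form that subdigraphs inherit unchanged; together with
-- out-degrees ≤ 1 it makes the underlying graph a forest.
record Branching {n} (g : Fin n → ℕ) (A : Digraph n) : Set where
  field
    height  : Fin n → ℕ
    descends : Descends height A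
    out≤1   : ∀ v → out A v ≤ 1
    in≤     : ∀ v → in′ A v ≤ g v
open Branching

Branching-mono : ∀ {n} {g} {A B : Digraph n} → B ⊆ A → Branching g A → Branching g B
Branching-mono s b = record
  { height = height b
  ; descends = λ u v e → descends b u v (s u v e)
  ; out≤1 = λ v → ≤-trans (out-mono s v) (out≤1 b v)
  ; in≤ = λ v → ≤-trans (in-mono s v) (in≤ b v) }

data Decomposition {n} (g : Fin n → ℕ) : ℕ → Digraph n → Set where
  piece : ∀ {A} → Branching g A → Decomposition g 1 A
  split : ∀ {A k l} (χ : Digraph n) → Decomposition g k (λ u v → A u v ∧ χ u v) →
          Decomposition g l (λ u v → A u v ∧ not (χ u v)) → Decomposition g (k + l) A

-- With caps `2 ^ k` and `2 ^ k * g v` every halving is exact, so no rounding error accumulates over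
-- the `k` rounds.
decompose-2^ : ∀ {n} {g h : Fin n → ℕ} k (A : Digraph n) → Descends h A →
  (∀ v → out A v ≤ 2 ^ k) → (∀ v → in′ A v ≤ 2 ^ k * g v) → Decomposition g (2 ^ k) A
decompose-2^ {h = h} zero A desc o≤ i≤ = piece record
  { height = h ; descends = desc ; out≤1 = o≤ ; in≤ = λ v → ≤-trans (i≤ v) (≤-reflexive (*-identityˡ _)) }
decompose-2^ {n} {g} {h} (suc k) A desc o≤ i≤ =
  subst (λ m → Decomposition g m A) (cong (2 ^ k +_) (sym (+-identityʳ _)))
    (halves (Halve.halve A (λ _ → 2 ^ k) (λ v → 2 ^ k * g v) o≤ i≤′))
  where
  i≤′ : ∀ v → in′ A v ≤ 2 * (2 ^ k * g v)
  i≤′ v = ≤-trans (i≤ v) (≤-reflexive (*-assoc 2 (2 ^ k) (g v)))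
  halves : Σ (Digraph n) (Halve.Halving A (λ _ → 2 ^ k) (λ v → 2 ^ k * g v) o≤ i≤′) →
    Decomposition g (2 ^ k + 2 ^ k) A
  halves (χ , os , is) = split χ
    (decompose-2^ k (λ u v → A u v ∧ χ u v) (λ u v e → desc u v (∧-trueˡ e))
      (λ v → proj₁ (os v)) (λ v → proj₁ (is v)))
    (decompose-2^ k (λ u v → A u v ∧ not (χ u v)) (λ u v e → desc u v (∧-trueˡ e))
      (λ v → proj₂ (os v)) (λ v → proj₂ (is v)))

eqℕ : ℕ → ℕ → Bool
eqℕ i j = does (i Data.Nat.≟ j)

-- `dec` accepts any digraph contained in a class because the class reached after several splits
-- carries the accumulated conjunctions and is only extensionally the set where `κ` equals `i`.
decompose-by : ∀ {n} {g : Fin n → ℕ} {S} P (κ : Fin n → Fin n → ℕ) (A : Digraph n) →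
  (∀ u v → A u v ≡ true → κ u v < suc P) →
  (∀ i → i < suc P → ∀ B → (∀ u v → B u v ≡ true → A u v ≡ true × κ u v ≡ i) → Decomposition g S B) →
  Decomposition g (suc P * S) A
decompose-by {g = g} {S} zero κ A κ< dec =
  subst (λ m → Decomposition g m A) (sym (+-identityʳ S))
    (dec 0 (s≤s z≤n) A (λ u v e → e , n≤0⇒n≡0 (≤-pred (κ< u v e))))
decompose-by {g = g} {S} (suc P) κ A κ< dec =
  split (λ u v → eqℕ (κ u v) (suc P))
    (dec (suc P) ≤-refl _ (λ u v e → ∧-trueˡ e , does-true (κ u v Data.Nat.≟ suc P) (∧-trueʳ {A u v} e)))
    (decompose-by P κ _
      (λ u v e → ≤∧≢⇒< (≤-pred (κ< u v (∧-trueˡ e)))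
        (λ q → true≢false (dec-true (κ u v Data.Nat.≟ suc P) q) (not-true (∧-trueʳ {A u v} e))))
      (λ i i< B sub → dec i (m<n⇒m<1+n i<) B (λ u v e → ∧-trueˡ (proj₁ (sub u v e)) , proj₂ (sub u v e))))

label : ∀ {n g k} {A : Digraph n} → Decomposition g k A → Fin n → Fin n → ℕ
label (piece _) u v = 0
label (split {k = k} χ d e) u v = if χ u v then label d u v else k + label e u v

label< : ∀ {n g k} {A : Digraph n} (d : Decomposition g k A) u v → label d u v < k
label< (piece _) u v = s≤s z≤n
label< (split {k = k} χ d e) u v with χ u v
... | true = m≤n⇒m≤n+o _ (label< d u v)
... | false = +-monoʳ-< k (label< e u v)

label-class : ∀ {n g k} {A : Digraph n} (d : Decomposition g k A) i → i < k →
  Branching g (λ u v → A u v ∧ eqℕ (label d u v) i)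
label-class (piece b) i _ = Branching-mono (λ u v → ∧-trueˡ) b
label-class {A = A} (split {k = k} {l} χ d e) i i<k+l with i <? k
... | yes i<k = Branching-mono sub (label-class d i i<k)
  where
  sub : ∀ u v → A u v ∧ eqℕ (if χ u v then label d u v else k + label e u v) i ≡ true →
    (A u v ∧ χ u v) ∧ eqℕ (label d u v) i ≡ true
  sub u v h with χ u v
  ... | true = ∧-true (∧-true (∧-trueˡ h) refl) (∧-trueʳ {A u v} h)
  ... | false = contradiction (does-true (_ Data.Nat.≟ i) (∧-trueʳ {A u v} h))
                  (λ q → <⇒≱ i<k (≤-trans (m≤m+n k _) (≤-reflexive q)))
... | no i≮k = Branching-mono sub (label-class e (i ∸ k) (+-cancelˡ-< k _ _ (≤-trans (s≤s (≤-reflexive k+)) i<k+l)))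
  where
  k+ : k + (i ∸ k) ≡ i
  k+ = m+[n∸m]≡n (≮⇒≥ i≮k)
  sub : ∀ u v → A u v ∧ eqℕ (if χ u v then label d u v else k + label e u v) i ≡ true →
    (A u v ∧ not (χ u v)) ∧ eqℕ (label e u v) (i ∸ k) ≡ true
  sub u v h with χ u v
  ... | true = contradiction (does-true (_ Data.Nat.≟ i) (∧-trueʳ {A u v} h))
                  (λ q → i≮k (subst (_< k) q (label< d u v)))
  ... | false = ∧-true (∧-true (∧-trueˡ h) refl) (dec-true (_ Data.Nat.≟ (i ∸ k))
                  (+-cancelˡ-≡ k _ _ (trans (does-true (_ Data.Nat.≟ i) (∧-trueʳ {A u v} h)) (sym k+))))

-- From branchings to degree-bounded forests

module ForestCertificate {n} {g : Fin n → ℕ} {A C : Digraph n} (b : Branching g A)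
  (oriented : ∀ u v → C u v ≡ true → A u v ≡ true ⊎ A v u ≡ true) where

  Arc : Fin n → Fin n → Set
  Arc u v = A u v ≡ true

  out-unique : ∀ {u v w} → Arc u v → Arc u w → v ≡ w
  out-unique {u} {v} {w} p q with v ≟ w
  ... | yes e = e
  ... | no v≢w = contradiction
    (≤-trans (subst (2 ≤_) (sym (cong₂ (λ x y → 𝟙 x + 𝟙 y) p q)) ≤-refl)
             (≤-trans (sum-two (λ x → 𝟙 (A u x)) v≢w) (out≤1 b u))) λ { (s≤s ()) }

  -- Out-arcs are unique and the last vertex `w` already points off the path, so, working back from
  -- the end, each vertex must point to its successor: an arc from `v` to `u` would be a second
  -- out-arc of `v`. Heights therefore fall along the path.
  forward : ∀ {u vs w z} → Path C (u ∷ vs) → Unique (u ∷ vs) → Last (u ∷ vs) w → Arc w z →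
    All (z ≢_) (u ∷ vs) → height b w ≤ height b u × (∃ λ y → Arc u y × (y ∈ vs ⊎ (vs ≡ [] × y ≡ z)))
  forward (single _) _ (here _) wz _ = ≤-refl , _ , wz , inj₂ (refl , refl)
  forward {u} {z = z} (step u v vs uv path) (u∉ ∷ uniq) (there _ _ w last) wz (z≢u ∷ z∉)
    with forward path uniq last wz z∉ | oriented u v uv
  ... | h≤ , _ | inj₁ p = ≤-trans h≤ (<⇒≤ (descends b u v p)) , v , p , inj₁ (here refl)
  ... | h≤ , y , vy , inj₁ y∈ | inj₂ p = contradiction (out-unique p vy) (All.lookup u∉ (there y∈))
  ... | h≤ , y , vy , inj₂ (_ , refl) | inj₂ p = contradiction (out-unique vy p) z≢u

  -- Mirror image: `u` has spent its only out-arc off the rest of the path, so the edge to `v` is an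
  -- arc into `u`, and so on; heights rise along the path.
  backward : ∀ {u vs w z} → Path C (u ∷ vs) → Unique (u ∷ vs) → Last (u ∷ vs) w → Arc u z →
    All (z ≢_) vs → height b u ≤ height b w
  backward (single _) _ (here _) _ _ = ≤-refl
  backward (step u v vs uv path) (u∉ ∷ uniq) (there _ _ w last) uz (z≢v ∷ z∉) with oriented u v uv
  ... | inj₁ p = contradiction (out-unique uz p) z≢v
  ... | inj₂ p = ≤-trans (<⇒≤ (descends b v u p)) (backward path uniq last p (All.tail u∉))

  last-∈ : ∀ {vs : List (Fin n)} {w} → Last vs w → w ∈ vs
  last-∈ (here _) = here refl
  last-∈ (there _ _ _ l) = there (last-∈ l)

  -- Either direction of the closing edge propagates round the cycle until heights contradict each
  -- other. The case where `u` points to both `v` and `w` falls to `v ≢ w`, which is where length at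
  -- least 3 enters.
  forest : IsForest C
  forest record { long = s≤s () ; path = single _ }
  forest record { long = s≤s (s≤s ()) ; path = step _ _ _ _ (single _) }
  forest record { distinct = u∉ ∷ v∉ ∷ uniq ; path = step u v (x ∷ xs) uv path ;
                  isFirst = _ , refl ; isLast = there _ _ w last ; closing = wu }
    with oriented w u wu
  ... | inj₁ p with forward path (v∉ ∷ uniq) last p u∉ | oriented u v uv
  ...   | h≤ , _ | inj₁ q = <⇒≱ (<-≤-trans (descends b w u p) ≤-refl) (≤-trans h≤ (<⇒≤ (descends b u v q)))
  ...   | h≤ , y , vy , inj₁ y∈ | inj₂ q = All.lookup u∉ (there y∈) (out-unique q vy)
  forest record { distinct = u∉ ∷ v∉ ∷ uniq ; path = step u v (x ∷ xs) uv path ;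
                  isFirst = _ , refl ; isLast = there _ _ w last ; closing = wu }
      | inj₂ p with oriented u v uv | last
  ...   | inj₁ q | there _ _ _ last' = All.lookup v∉ (last-∈ last') (out-unique q p)
  ...   | inj₂ q | _ = <⇒≱ (descends b u w p)
                        (≤-trans (<⇒≤ (descends b v u q)) (backward path (v∉ ∷ uniq) last q (All.tail u∉)))

to-colouring : ∀ {n k} (G : Graph n) (f : Fin n → ℕ) → (∀ v → 2 ≤ f v) → 0 < k →
  ∀ o → Orients (adj G) o → Decomposition (λ v → f v ∸ 1) k o → FForestColourable G f k
to-colouring {n} {k} G f 2≤f 0<k o s d = colouring , λ i → forest' i , degree' i
  where
  lab : Fin n → Fin n → ℕ
  lab u v = if o u v then label d u v else if o v u then label d v u else 0
  lab< : ∀ u v → lab u v < k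
  lab< u v with o u v | o v u
  ... | true | _ = label< d u v
  ... | false | true = label< d v u
  ... | false | false = 0<k
  lab-sym : ∀ u v → lab u v ≡ lab v u
  lab-sym u v with o u v in e | o v u in e'
  ... | true | true = ⊥-elim (true≢false e' (orient-antisym s e))
  ... | true | false = refl
  ... | false | true = refl
  ... | false | false = refl
  colouring : EdgeColouring k
  colouring = record
    { col = λ u v → fromℕ< (lab< u v)
    ; colSym = λ u v → fromℕ<-cong _ _ (lab-sym u v) (lab< u v) (lab< v u) }
  A : Fin k → Digraph n
  A i u v = o u v ∧ eqℕ (label d u v) (toℕ i)
  C : Fin k → Digraph n
  C = colourClass G colouring
  b : ∀ i → Branching (λ v → f v ∸ 1) (A i)
  b i = label-class d (toℕ i) (toℕ<n i)
  covers : ∀ i u v → C i u v ≡ true → A i u v ≡ true ⊎ A i v u ≡ true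
  covers i u v h = cover (trans (sym (toℕ-fromℕ< (lab< u v))) (cong toℕ (does-true (_ ≟ i) (∧-trueʳ {adj G u v} h))))
    where
    cover : lab u v ≡ toℕ i → A i u v ≡ true ⊎ A i v u ≡ true
    cover q with o u v | o v u | trans (sym (cong 𝟙 (∧-trueˡ {adj G u v} h))) (s .once u v)
    ... | true | _ | _ = inj₁ (dec-true (_ Data.Nat.≟ _) q)
    ... | false | true | _ = inj₂ (dec-true (_ Data.Nat.≟ _) q)
    ... | false | false | ()
  forest' : ∀ i → IsForest (C i)
  forest' i = ForestCertificate.forest (b i) (covers i)
  degree' : ∀ i v → degreeIn (C i) v ≤ f v
  degree' i v = begin
    degreeIn (C i) v ≤⟨ sum-mono pt ⟩
    sumFin (λ u → 𝟙 (A i v u) + 𝟙 (A i u v)) ≡⟨ sum-+ (λ u → 𝟙 (A i v u)) (λ u → 𝟙 (A i u v)) ⟩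
    out (A i) v + in′ (A i) v ≤⟨ +-mono-≤ (out≤1 (b i) v) (in≤ (b i) v) ⟩
    1 + (f v ∸ 1) ≡⟨ m+[n∸m]≡n (≤-trans (s≤s z≤n) (2≤f v)) ⟩
    f v ∎
    where
    open ≤-Reasoning
    pt : ∀ u → 𝟙 (C i v u) ≤ 𝟙 (A i v u) + 𝟙 (A i u v)
    pt u with C i v u in e
    ... | false = z≤n
    ... | true with covers i v u e
    ...   | inj₁ p rewrite p = s≤s z≤n
    ...   | inj₂ p rewrite p = m≤n+m 1 _

-- Orienting forests

module Forest {n} (C : Digraph n) (C-sym : ∀ u v → C u v ≡ C v u) (C-irr : ∀ v → C v v ≡ false)
  (forest : IsForest C) where

  open DecMembership (_≟_ {n}) using (_∈?_)

  prefix : ∀ {x xs y} → Path C (x ∷ xs) → Unique (x ∷ xs) → y ∈ x ∷ xs →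
    ∃ λ ws → Path C (x ∷ ws) × Unique (x ∷ ws) × Last (x ∷ ws) y × (∀ {z} → z ∈ ws → z ∈ xs)
  prefix {x} _ _ (here refl) = [] , single x , [] ∷ [] , here x , λ ()
  prefix (step x y ys e path) (x∉ ∷ uniq) (there y∈) with prefix path uniq y∈
  ... | ws , path' , uniq' , last , sub =
    y ∷ ws , step x y ws e path' , All.tabulate (All.lookup x∉ ∘ sub') ∷ uniq' , there _ _ _ last , sub'
    where
    sub' : ∀ {z} → z ∈ y ∷ ws → z ∈ y ∷ ys
    sub' (here e) = here e
    sub' (there z∈) = there (sub z∈)

  -- The edge from `u` back to `y` closes up the part of the path that ends at `y`; taking `y`
  -- beyond the second vertex gives length at least 3.
  close : ∀ {u w xs y} → Path C (u ∷ w ∷ xs) → Unique (u ∷ w ∷ xs) → y ∈ xs → C u y ≡ true → ⊥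
  close {xs = x ∷ xs} {y} (step u w _ uw (step _ _ _ wx path)) (u∉ ∷ w∉ ∷ uniq) y∈ uy
    with prefix path uniq y∈
  ... | ws , path' , uniq' , last , sub = forest record
    { verts = u ∷ w ∷ x ∷ ws
    ; long = s≤s (s≤s (s≤s z≤n))
    ; distinct = (All.head u∉ ∷ All.tabulate (All.lookup (All.tail u∉) ∘ sub'))
                 ∷ All.tabulate (All.lookup w∉ ∘ sub') ∷ uniq'
    ; path = step u w _ uw (step w x _ wx path')
    ; first = u ; last = y ; isFirst = _ , refl
    ; isLast = there _ _ _ (there _ _ _ last)
    ; closing = trans (C-sym y u) uy }
    where
    sub' : ∀ {z} → z ∈ x ∷ ws → z ∈ x ∷ xs
    sub' (here e) = here e
    sub' (there z∈) = there (sub z∈)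

  degIn : (Fin n → Bool) → Fin n → ℕ
  degIn R u = sumFin (λ v → 𝟙 (R v ∧ C u v))

  module _ (R : Fin n → Bool) (deg≥2 : ∀ u → R u ≡ true → 2 ≤ degIn R u) where

    neighbour : ∀ u w → R u ≡ true → ∃ λ y → y ≢ w × R y ≡ true × C u y ≡ true
    neighbour u w Ru with any? (λ y → ¬? (y ≟ w) ×-dec ((R y ∧ C u y) Data.Bool.≟ true))
    ... | yes (y , ne , e) = y , ne , ∧-trueˡ e , ∧-trueʳ {R y} e
    ... | no none = contradiction (≤-trans (deg≥2 u Ru) (≤-trans (sum-mono pt) (≤-reflexive (sum-δ w)))) λ { (s≤s ()) }
      where
      pt : ∀ v → 𝟙 (R v ∧ C u v) ≤ 𝟙 (eqᵇ v w)
      pt v with R v ∧ C u v in e | v ≟ w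
      ... | false | _ = z≤n
      ... | true | yes _ = ≤-refl
      ... | true | no ne = contradiction (v , ne , e) none

    member : List (Fin n) → Fin n → Bool
    member p i = does (i ∈? p)

    member-grows : ∀ p y → ¬ y ∈ p → count (member p) < count (member (y ∷ p))
    member-grows p y y∉ = sum-mono-<
      (λ i → 𝟙-mono {member p i} (λ e → dec-true (i ∈? (y ∷ p)) (there (does-true (i ∈? p) e)))) y
      (subst₂ _<_ (cong 𝟙 (sym (dec-false (y ∈? p) y∉))) (cong 𝟙 (sym (dec-true (y ∈? (y ∷ p)) (here refl)))) ≤-refl)

    -- Degree at least 2 inside `R` lets the path continue from `u` by an edge other than the one to
    -- `w`. It either returns to itself and closes a cycle, or grows, which can happen fewer than
    -- `n` times.
    extend : ∀ k u w rest → n < k + count (member (u ∷ w ∷ rest)) → Path C (u ∷ w ∷ rest) →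
      Unique (u ∷ w ∷ rest) → R u ≡ true → ⊥
    extend zero u w rest l _ _ _ = <⇒≱ l (count≤ (member (u ∷ w ∷ rest)))
    extend (suc k) u w rest l path uniq Ru with neighbour u w Ru
    ... | y , y≢w , Ry , uy with y ∈? (u ∷ w ∷ rest)
    ...   | yes (here refl) = true≢false uy (C-irr u)
    ...   | yes (there (here e)) = y≢w e
    ...   | yes (there (there y∈)) = close path uniq y∈ uy
    ...   | no y∉ = extend k y u (w ∷ rest)
      (≤-trans l (≤-trans (≤-reflexive (sym (+-suc k _))) (+-monoʳ-≤ k (member-grows _ y y∉))))
      (step y u _ (trans (C-sym y u) uy) path)
      (All.tabulate (λ z∈ e → y∉ (subst (_∈ _) (sym e) z∈)) ∷ uniq) Ry

    no-core : ∀ u → R u ≡ true → ⊥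
    no-core u Ru with neighbour u u Ru
    ... | y , y≢u , Ry , uy =
      extend (suc n) y u [] (m≤m+n _ _) (step y u [] (trans (C-sym y u) uy) (single u))
        ((y≢u ∷ []) ∷ [] ∷ []) Ry

  -- `off` forbids arcs into vertices outside `R`: when a removed vertex `x` is put back, no old arc
  -- enters it, so its edge can be directed out of `x` without being counted twice.
  record OrientsOn (R : Fin n → Bool) (o : Digraph n) : Set where
    field
      on   : ∀ u v → R u ≡ true → R v ≡ true → 𝟙 (C u v) ≡ 𝟙 (o u v) + 𝟙 (o v u)
      off  : ∀ u v → R v ≡ false → o u v ≡ false
      out≤ : ∀ v → out o v ≤ 1
  open OrientsOn

  remove : (Fin n → Bool) → Fin n → Fin n → Bool
  remove R x i = R i ∧ not (eqᵇ i x)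

  remove-self : ∀ (R : Fin n → Bool) x → remove R x x ≡ false
  remove-self R x rewrite eqᵇ-refl x = ∧-comm (R x) false

  remove-∈ : ∀ (R : Fin n → Bool) {x i} → i ≢ x → R i ≡ true → remove R x i ≡ true
  remove-∈ R {x} {i} ne e rewrite dec-false (i ≟ x) ne | e = refl

  -- By `no-core`, a nonempty `R` has a vertex with at most one neighbour in `R`. Orient the rest
  -- and direct its remaining edge, if any, outwards.
  peel : ∀ k (R : Fin n → Bool) → count R ≤ k → Σ (Digraph n) (OrientsOn R)
  peel k R l with any? (λ x → (R x Data.Bool.≟ true) ×-dec (degIn R x ≤? 1))
  peel k R l | no none = (λ _ _ → false) , record
    { on = λ u v Ru _ → ⊥-elim (no-core R (λ x Rx → ≰⇒> (λ d → none (x , Rx , d))) u Ru)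
    ; off = λ _ _ _ → refl
    ; out≤ = λ v → ≤-trans (≤-reflexive (sum-zero {n} (λ _ → refl))) z≤n }
  peel zero R l | yes (x , Rx , d) =
    contradiction (≤-trans (subst (λ b → 1 ≤ 𝟙 b) (sym Rx) ≤-refl) (≤-trans (sum-∋ (λ i → 𝟙 (R i)) x) l)) λ ()
  peel (suc k) R l | yes (x , Rx , d) with peel k (remove R x) (≤-pred (<-≤-trans smaller l))
    where
    smaller : count (remove R x) < count R
    smaller = sum-mono-< (λ i → 𝟙-mono {remove R x i} ∧-trueˡ) x
      (subst₂ _<_ (cong 𝟙 (sym (remove-self R x))) (cong 𝟙 (sym Rx)) ≤-refl)
  ... | o , s = o⁺ , record { on = on⁺ ; off = off⁺ ; out≤ = out⁺ }
    where
    o⁺ : Digraph n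
    o⁺ u v = if eqᵇ u x then R v ∧ C x v else o u v
    o-x : ∀ u → o u x ≡ false
    o-x u = off s u x (remove-self R x)
    on⁺ : ∀ u v → R u ≡ true → R v ≡ true → 𝟙 (C u v) ≡ 𝟙 (o⁺ u v) + 𝟙 (o⁺ v u)
    on⁺ u v Ru Rv with u ≟ x | v ≟ x
    ... | yes refl | yes refl rewrite C-irr x | ∧-comm (R x) false = refl
    ... | yes refl | no _ rewrite Rv | o-x v = sym (+-identityʳ _)
    ... | no _ | yes refl rewrite Ru | o-x u = cong 𝟙 (C-sym u x)
    ... | no u≢x | no v≢x = on s u v (remove-∈ R u≢x Ru) (remove-∈ R v≢x Rv)
    off⁺ : ∀ u v → R v ≡ false → o⁺ u v ≡ false
    off⁺ u v Rv with u ≟ x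
    ... | yes refl rewrite Rv = refl
    ... | no _ = off s u v (cong (_∧ not (eqᵇ v x)) Rv)
    out⁺ : ∀ v → out o⁺ v ≤ 1
    out⁺ v with v ≟ x
    ... | yes refl = d
    ... | no _ = out≤ s v

  orientation : Σ (Digraph n) λ o → Orients C o × (∀ v → out o v ≤ 1)
  orientation with peel n (λ _ → true) (count≤ (λ _ → true))
  ... | o , s = o , orients (λ u v → on s u v refl refl) , out≤ s

-- Each colour class, oriented as a forest, contributes at most one out-arc at every vertex.
arboricity-orientation : ∀ {n k} (G : Graph n) → ForestColourable G k →
  Σ (Digraph n) λ o → Orients (adj G) o × (∀ v → out o v ≤ k)
arboricity-orientation {n} {k} G (c , forests) = o , orients once' , out≤
  where
  C : Fin k → Digraph n
  C = colourClass G c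
  C-sym : ∀ i u v → C i u v ≡ C i v u
  C-sym i u v = cong₂ (λ a x → a ∧ does (x ≟ i)) (Graph.sym G u v) (colSym c u v)
  module F i = Forest (C i) (C-sym i) (λ v → cong (_∧ does (col c v v ≟ i)) (irrefl G v)) (forests i)
  o : Digraph n
  o u v = proj₁ (F.orientation (col c u v)) u v
  once' : ∀ u v → 𝟙 (adj G u v) ≡ 𝟙 (o u v) + 𝟙 (o v u)
  once' u v = begin
    𝟙 (adj G u v) ≡⟨ cong 𝟙 (sym (trans (cong (adj G u v ∧_) (eqᵇ-refl (col c u v))) (∧-comm (adj G u v) true))) ⟩
    𝟙 (C (col c u v) u v) ≡⟨ proj₁ (proj₂ (F.orientation (col c u v))) .once u v ⟩
    𝟙 (o u v) + 𝟙 (proj₁ (F.orientation (col c u v)) v u) ≡⟨ cong (λ i → 𝟙 (o u v) + 𝟙 (proj₁ (F.orientation i) v u)) (colSym c u v) ⟩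
    𝟙 (o u v) + 𝟙 (o v u) ∎
    where open ≡-Reasoning
  out≤ : ∀ v → out o v ≤ k
  out≤ v = begin
    out o v ≤⟨ sum-mono (λ u → sum-∋ (λ i → 𝟙 (proj₁ (F.orientation i) v u)) (col c v u)) ⟩
    sumFin (λ u → sumFin (λ i → 𝟙 (proj₁ (F.orientation i) v u))) ≡⟨ sum-swap (λ u i → 𝟙 (proj₁ (F.orientation i) v u)) ⟩
    sumFin (λ i → out (proj₁ (F.orientation i)) v) ≤⟨ sum-mono (λ i → proj₂ (proj₂ (F.orientation i)) v) ⟩
    sumFin {k} (λ _ → 1) ≡⟨ sum-const k 1 ⟩
    k * 1 ≡⟨ *-identityʳ k ⟩
    k ∎
    where open ≤-Reasoning

-- The zigzag decomposition

module Zigzag (p : ℕ) where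

  -- Slot s contains the pairs x < y with x + y ≡ s and the pairs x > y with x + y ≡ s + 1,
  -- modulo p + 1: arcs x → s − x → x + 1 → s − x − 1 → …
  Arc : ℕ → ℕ → ℕ → Set
  Arc s x y = ∃ λ e → (x < y × x + y ≡ s + e * suc p) ⊎ (y < x × x + y ≡ suc (s + e * suc p))

  slot : ∀ {x y} → x ≢ y → ℕ
  slot {x} {y} _ with <-cmp x y
  ... | tri< _ _ _ = (x + y) % suc p
  ... | tri≈ _ _ _ = 0
  ... | tri> _ _ _ = pred (x + y) % suc p

  slot≤ : ∀ {x y} (ne : x ≢ y) → slot ne ≤ p
  slot≤ {x} {y} ne with <-cmp x y
  ... | tri< _ _ _ = ≤-pred (m%n<n (x + y) (suc p))
  ... | tri≈ _ _ _ = z≤n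
  ... | tri> _ _ _ = ≤-pred (m%n<n (pred (x + y)) (suc p))

  slot-arc : ∀ {x y} (ne : x ≢ y) → Arc (slot ne) x y
  slot-arc {x} {y} ne with <-cmp x y
  ... | tri< l _ _ = (x + y) / suc p , inj₁ (l , m≡m%n+[m/n]*n (x + y) (suc p))
  ... | tri≈ _ e _ = contradiction e ne
  slot-arc {suc x} {y} ne | tri> _ _ l =
    (x + y) / suc p , inj₂ (l , cong suc (m≡m%n+[m/n]*n (x + y) (suc p)))

  mod-injective : ∀ {y y'} e e' → y ≤ p → y' ≤ p → y + e' * suc p ≡ y' + e * suc p → y ≡ y'
  mod-injective {y} {y'} e e' l l' q = begin
    y ≡⟨ m<n⇒m%n≡m (s≤s l) ⟨
    y % suc p ≡⟨ [m+kn]%n≡m%n y e' (suc p) ⟨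
    (y + e' * suc p) % suc p ≡⟨ cong (_% suc p) q ⟩
    (y' + e * suc p) % suc p ≡⟨ [m+kn]%n≡m%n y' e (suc p) ⟩
    y' % suc p ≡⟨ m<n⇒m%n≡m (s≤s l') ⟩
    y' ∎
    where open ≡-Reasoning

  cross-add : ∀ {x y y' k k' s} → x + y ≡ s + k → x + y' ≡ s + k' → y + k' ≡ y' + k
  cross-add {x} {y} {y'} {k} {k'} {s} q q' = +-cancelˡ-≡ (x + s) _ _ (begin
    (x + s) + (y + k') ≡⟨ +-swap-middle x s y k' ⟩
    (x + y) + (s + k') ≡⟨ cong₂ _+_ q (sym q') ⟩
    (s + k) + (x + y') ≡⟨ l s k x y' ⟩
    (x + s) + (y' + k) ∎)
    where
    open ≡-Reasoning
    l : ∀ s k x y' → (s + k) + (x + y') ≡ (x + s) + (y' + k)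
    l = solve-∀

  same : ∀ {x y y' s} e e' → y < p → y' < p → x + y ≡ s + e * suc p → x + y' ≡ s + e' * suc p → y ≡ y'
  same {x} {y} {y'} e e' l l' q q' =
    mod-injective e e' (<⇒≤ l) (<⇒≤ l') (cross-add {x} {y} {y'} q q')

  -- This is the reason for the modulus `p + 1`: for `y < p` the number `y + 1` is still a reduced
  -- residue, so its congruence to `y'` is an equality. Modulo `p` it could wrap round.
  next : ∀ {x y y' s} e e' → y < p → y' < p →
    x + y ≡ s + e * suc p → x + y' ≡ suc (s + e' * suc p) → suc y ≡ y'
  next {x} {y} {y'} e e' l l' q q' = mod-injective e e' l (<⇒≤ l')
    (cross-add {x} {suc y} {y'} (trans (+-suc x y) (cong suc q)) q')

  -- Heads of two arcs with the same direction agree modulo `p + 1`. An upward and a downward arc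
  -- would have heads `y > x` and `y' = y + 1 < x`.
  arc-out : ∀ {s x y y'} → y < p → y' < p → Arc s x y → Arc s x y' → y ≡ y'
  arc-out {x = x} l l' (e , inj₁ (_ , q)) (e' , inj₁ (_ , q')) = same {x} e e' l l' q q'
  arc-out {s} {x} l l' (e , inj₂ (_ , q)) (e' , inj₂ (_ , q')) = same {x} {s = suc s} e e' l l' q q'
  arc-out {x = x} l l' (e , inj₁ (x<y , q)) (e' , inj₂ (y'<x , q')) =
    contradiction (≤-trans (s≤s (≤-trans (n≤1+n x) x<y)) (≤-reflexive (next {x} e e' l l' q q'))) (<-asym y'<x)
  arc-out {x = x} l l' (e , inj₂ (y<x , q)) (e' , inj₁ (x<y' , q')) =
    contradiction (≤-trans (s≤s (≤-trans (n≤1+n x) x<y')) (≤-reflexive (next {x} e' e l' l q' q))) (<-asym y<x)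

  arc-in : ∀ {s x x' y} → x < p → x' < p → Arc s x y → Arc s x' y → x ≡ x'
  arc-in {s} {x} {x'} {y} l l' (e , a) (e' , a') = go a a'
    where
    c = +-comm y x
    c' = +-comm y x'
    go : (x < y × x + y ≡ s + e * suc p) ⊎ (y < x × x + y ≡ suc (s + e * suc p)) →
         (x' < y × x' + y ≡ s + e' * suc p) ⊎ (y < x' × x' + y ≡ suc (s + e' * suc p)) → x ≡ x'
    go (inj₁ (_ , q)) (inj₁ (_ , q')) = same {y} e e' l l' (trans c q) (trans c' q')
    go (inj₂ (_ , q)) (inj₂ (_ , q')) = same {y} {s = suc s} e e' l l' (trans c q) (trans c' q')
    go (inj₁ (x<y , q)) (inj₂ (y<x' , q')) =
      contradiction (subst (y <_) (sym (next {y} e e' l l' (trans c q) (trans c' q'))) y<x') (≤⇒≯ x<y)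
    go (inj₂ (y<x , q)) (inj₁ (x'<y , q')) =
      contradiction (subst (y <_) (sym (next {y} e' e l' l (trans c' q') (trans c q))) y<x) (≤⇒≯ x'<y)

  -- Four times the distance from `x` to `σ/2 + 1/4`. Upward arcs reflect in `σ/2` and downward arcs
  -- in `σ/2 + 1/2`; the chosen point lies 1/4 from either centre, on the side of the head. So the
  -- path spirals inwards, and `gap` falls by 2 along each arc.
  gap : ℕ → ℕ → ℕ
  gap σ x = ∣ 4 * x - (2 * σ + 1) ∣

  gap-up : ∀ {σ x y} → x < y → x + y ≡ σ → gap σ y < gap σ x
  gap-up {σ} {x} {y} x<y refl with m<n⇒∃ x<y
    where
    m<n⇒∃ : ∀ {m n} → m < n → ∃ λ k → n ≡ suc (m + k)
    m<n⇒∃ {m} l = _ , sym (m+[n∸m]≡n l)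
  ... | k , refl = subst₂ _<_ (sym gy) (sym gx) (s≤s (m≤n+m _ 1))
    where
    gy : gap (x + suc (x + k)) (suc (x + k)) ≡ 1 + 2 * k
    gy = trans (cong (λ z → ∣ z - (2 * (x + suc (x + k)) + 1) ∣) (l x k))
               (trans (∣-∣-comm (2 * (x + suc (x + k)) + 1 + (1 + 2 * k)) _) (∣m-m+n∣≡n (2 * (x + suc (x + k)) + 1) _))
      where
      l : ∀ x k → 4 * suc (x + k) ≡ 2 * (x + suc (x + k)) + 1 + (1 + 2 * k)
      l = solve-∀
    gx : gap (x + suc (x + k)) x ≡ 3 + 2 * k
    gx = trans (cong (λ z → ∣ 4 * x - z ∣) (l x k)) (∣m-m+n∣≡n (4 * x) _)
      where
      l : ∀ x k → 2 * (x + suc (x + k)) + 1 ≡ 4 * x + (3 + 2 * k)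
      l = solve-∀

  gap-down : ∀ {σ x y} → y < x → x + y ≡ suc σ → gap σ y < gap σ x
  gap-down {σ} {x} {y} y<x q = subst₂ _<_ (sym gy) (sym gx) (s≤s (m≤n+m _ 1))
    where
    k = x ∸ suc y
    ex : x ≡ suc (y + k)
    ex = sym (m+[n∸m]≡n y<x)
    eσ : σ ≡ 2 * y + k
    eσ = suc-injective (trans (sym q) (trans (cong (_+ y) ex) (l y k)))
      where
      l : ∀ y k → suc (y + k) + y ≡ suc (2 * y + k)
      l = solve-∀
    gy : gap σ y ≡ 1 + 2 * k
    gy = trans (cong (λ z → ∣ 4 * y - z ∣) (trans (cong (λ z → 2 * z + 1) eσ) (l y k))) (∣m-m+n∣≡n (4 * y) _)
      where
      l : ∀ y k → 2 * (2 * y + k) + 1 ≡ 4 * y + (1 + 2 * k)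
      l = solve-∀
    gx : gap σ x ≡ 3 + 2 * k
    gx = trans (cong₂ (λ z w → ∣ z - w ∣) (trans (cong (4 *_) ex) (l y k)) (cong (λ z → 2 * z + 1) eσ))
               (trans (∣-∣-comm (2 * (2 * y + k) + 1 + (3 + 2 * k)) _) (∣m-m+n∣≡n (2 * (2 * y + k) + 1) _))
      where
      l : ∀ y k → 4 * suc (y + k) ≡ 2 * (2 * y + k) + 1 + (3 + 2 * k)
      l = solve-∀

  -- The two residues s and s + p + 1 live on the disjoint blocks x ≤ s + 1 and x ≥ s + 2.
  level : ℕ → ℕ → ℕ
  level s x = gap (if does (x ≤? suc s) then s else s + suc p) x

  level-low : ∀ {s x} → x ≤ suc s → level s x ≡ gap s x
  level-low {s} {x} l rewrite dec-true (x ≤? suc s) l = refl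

  level-high : ∀ {s x} → suc s < x → level s x ≡ gap (s + suc p) x
  level-high {s} {x} l rewrite dec-false (x ≤? suc s) (<⇒≱ l) = refl

  arc-gap : ∀ {σ x y} → (x < y × x + y ≡ σ) ⊎ (y < x × x + y ≡ suc σ) →
    gap σ y < gap σ x × σ ≤ x + y × x + y ≤ suc σ
  arc-gap {σ} (inj₁ (l , refl)) = gap-up l refl , ≤-refl , n≤1+n σ
  arc-gap {σ} {x} {y} (inj₂ (l , q)) =
    gap-down l q , ≤-trans (n≤1+n σ) (≤-reflexive (sym q)) , ≤-reflexive q

  -- As `x` and `y` are below `p`, their sum is below `2 (p + 1)`, so the quotient `e` is 0 or 1;
  -- its value decides on which block both ends lie.
  arc-level : ∀ {s x y} → x < p → y < p → Arc s x y → level s y < level s x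
  arc-level {s} {x} {y} x<p y<p (zero , a) rewrite +-identityʳ s with arc-gap a
  ... | lt , _ , ≤s = subst₂ _<_ (sym (level-low (≤-trans (m≤n+m y x) ≤s)))
                                 (sym (level-low (≤-trans (m≤m+n x y) ≤s))) lt
  arc-level {s} {x} {y} x<p y<p (suc zero , a) rewrite +-identityʳ p with arc-gap a
  ... | lt , s≤ , _ = subst₂ _<_ (sym (level-high (high {y} x<p (≤-trans s≤ (≤-reflexive (+-comm x y))))))
                                 (sym (level-high (high {x} y<p s≤))) lt
    where
    high : ∀ {x' y'} → y' < p → s + suc p ≤ x' + y' → suc s < x'
    high {x'} {y'} l q = +-cancelʳ-< y' _ _ (≤-trans (≤-trans (≤-reflexive eq) (+-monoʳ-≤ s (s≤s l))) q)
      where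
      eq : suc (suc s + y') ≡ s + suc (suc y')
      eq = trans (cong suc (sym (+-suc s y'))) (sym (+-suc s (suc y')))
  arc-level {s} {x} {y} x<p y<p (suc (suc e) , a) with arc-gap a
  ... | _ , s≤ , _ = contradiction (+-mono-< x<p y<p) (≤⇒≯ (≤-trans big s≤))
    where
    big : p + p ≤ s + (suc p + (suc p + e * suc p))
    big = ≤-trans (+-mono-≤ (n≤1+n p) (≤-trans (n≤1+n p) (m≤m+n _ _))) (m≤n+m _ s)

-- Decomposition from a spread vertex colouring

module ColourDecompose {n p} (A : Digraph n) (irr : ∀ v → A v v ≡ false) (c : Fin n → Fin p)
  (g : Fin n → ℕ) (k : ℕ)
  (out≤ : ∀ u y → sumFin (λ v → 𝟙 (A u v ∧ eqᵇ (c v) y)) ≤ 2 ^ k)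
  (in≤ : ∀ v x → sumFin (λ u → 𝟙 (A u v ∧ eqᵇ (c u) x)) ≤ 2 ^ k * g v) where

  open Zigzag p

  -- In a slot, as inside the colour classes, all out-neighbours of a vertex share one colour, and
  -- so do all in-neighbours; the bound per colour thus bounds the whole degree.
  one-colour : ∀ {m} {P Q : Fin n → Bool} (b : Fin n → Fin p) → (∀ v → P v ≡ true → Q v ≡ true) →
    (∀ v w → P v ≡ true → P w ≡ true → b v ≡ b w) →
    (∀ y → sumFin (λ v → 𝟙 (Q v ∧ eqᵇ (b v) y)) ≤ m) → sumFin (λ v → 𝟙 (P v)) ≤ m
  one-colour {P = P} {Q} b P⇒Q const bound with any? (λ v → P v Data.Bool.≟ true)
  ... | yes (v , Pv) = ≤-trans (sum-mono (λ w → 𝟙-mono {P w} {Q w ∧ eqᵇ (b w) (b v)}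
          (λ Pw → ∧-true (P⇒Q w Pw) (dec-true (b w ≟ b v) (const w v Pw Pv))))) (bound (b v))
  ... | no none = ≤-trans (≤-reflexive (sum-zero (λ v → cong 𝟙 (contra (λ e → contradiction (v , e) none) refl)))) z≤n

  decompose-class : ∀ {h} B → B ⊆ A → Descends h B →
    (∀ u v w → B u v ≡ true → B u w ≡ true → c v ≡ c w) →
    (∀ u v w → B v u ≡ true → B w u ≡ true → c v ≡ c w) → Decomposition g (2 ^ k) B
  decompose-class {h} B sub desc o i = decompose-2^ {h = h} k B desc
    (λ u → one-colour c (sub u) (o u) (out≤ u))
    (λ v → one-colour c (λ u → sub u v) (i v) (in≤ v))

  κ : Fin n → Fin n → ℕ
  κ u v with toℕ (c u) Data.Nat.≟ toℕ (c v) | toℕ u <? toℕ v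
  ... | no ne | _ = slot ne
  ... | yes _ | yes _ = suc p
  ... | yes _ | no _ = 2 + p

  κ< : ∀ u v → κ u v < 3 + p
  κ< u v with toℕ (c u) Data.Nat.≟ toℕ (c v) | toℕ u <? toℕ v
  ... | no ne | _ = s≤s (≤-trans (slot≤ ne) (m≤n+m p 2))
  ... | yes _ | yes _ = n≤1+n _
  ... | yes _ | no _ = ≤-refl

  Spec : ℕ → Fin n → Fin n → Set
  Spec i u v = (i ≤ p × Arc i (toℕ (c u)) (toℕ (c v)))
             ⊎ (i ≡ suc p × c u ≡ c v × toℕ u < toℕ v)
             ⊎ (i ≡ 2 + p × c u ≡ c v × toℕ v ≤ toℕ u)

  κ-spec : ∀ u v → Spec (κ u v) u v
  κ-spec u v with toℕ (c u) Data.Nat.≟ toℕ (c v) | toℕ u <? toℕ v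
  ... | no ne | _ = inj₁ (slot≤ ne , slot-arc ne)
  ... | yes e | yes l = inj₂ (inj₁ (refl , toℕ-injective e , l))
  ... | yes e | no ¬l = inj₂ (inj₂ (refl , toℕ-injective e , ≮⇒≥ ¬l))

  decomposition : Decomposition g ((3 + p) * 2 ^ k) A
  decomposition = decompose-by (2 + p) κ A (λ u v _ → κ< u v) class
    where
    class : ∀ i → i < 3 + p → ∀ B → (∀ u v → B u v ≡ true → A u v ≡ true × κ u v ≡ i) → Decomposition g (2 ^ k) B
    class i i< B sub = by-slot (i ≤? p) (i Data.Nat.≟ suc p)
      where
      spec : ∀ u v → B u v ≡ true → Spec i u v
      spec u v b = subst (λ i → Spec i u v) (proj₂ (sub u v b)) (κ-spec u v)
      B⊆A : B ⊆ A
      B⊆A u v b = proj₁ (sub u v b)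
      by-slot : Dec (i ≤ p) → Dec (i ≡ suc p) → Decomposition g (2 ^ k) B
      by-slot (yes i≤p) _ = decompose-class {h = λ u → level i (toℕ (c u))} B B⊆A
        (λ u v b → arc-level (toℕ<n (c u)) (toℕ<n (c v)) (arc u v b))
        (λ u v w b b' → toℕ-injective (arc-out (toℕ<n (c v)) (toℕ<n (c w)) (arc u v b) (arc u w b')))
        (λ u v w b b' → toℕ-injective (arc-in (toℕ<n (c v)) (toℕ<n (c w)) (arc v u b) (arc w u b')))
        where
        arc : ∀ u v → B u v ≡ true → Arc i (toℕ (c u)) (toℕ (c v))
        arc u v b with spec u v b
        ... | inj₁ (_ , a) = a
        ... | inj₂ (inj₁ (refl , _)) = contradiction i≤p (<⇒≱ ≤-refl)
        ... | inj₂ (inj₂ (refl , _)) = contradiction i≤p (<⇒≱ (n≤1+n _))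
      by-slot (no i≰p) (yes i≡) = decompose-class {h = λ u → n ∸ toℕ u} B B⊆A
        (λ u v b → ∸-monoʳ-< (proj₂ (arc u v b)) (<⇒≤ (toℕ<n v)))
        (λ u v w b b' → trans (sym (proj₁ (arc u v b))) (proj₁ (arc u w b')))
        (λ u v w b b' → trans (proj₁ (arc v u b)) (sym (proj₁ (arc w u b'))))
        where
        arc : ∀ u v → B u v ≡ true → c u ≡ c v × toℕ u < toℕ v
        arc u v b with spec u v b
        ... | inj₁ (i≤p , _) = contradiction i≤p i≰p
        ... | inj₂ (inj₁ (_ , a)) = a
        ... | inj₂ (inj₂ (e , _)) = contradiction (trans (sym e) i≡) (1+n≢n {suc p})
      by-slot (no i≰p) (no i≢) = decompose-class {h = toℕ} B B⊆A
        (λ u v b → ≤∧≢⇒< (proj₂ (arc u v b)) (λ e → true≢false (B⊆A u v b) (trans (cong (A u) (toℕ-injective e)) (irr u))))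
        (λ u v w b b' → trans (sym (proj₁ (arc u v b))) (proj₁ (arc u w b')))
        (λ u v w b b' → trans (proj₁ (arc v u b)) (sym (proj₁ (arc w u b'))))
        where
        arc : ∀ u v → B u v ≡ true → c u ≡ c v × toℕ v ≤ toℕ u
        arc u v b with spec u v b
        ... | inj₁ (i≤p , _) = contradiction i≤p i≰p
        ... | inj₂ (inj₁ (e , _)) = contradiction e i≢
        ... | inj₂ (inj₂ (_ , a)) = a

-- The symmetric local lemma, by counting

-- `p ^ n` times the expectation under a uniformly random colouring; for an indicator, the number of
-- colourings in the event.
total : ∀ {p} n → (Vec (Fin p) n → ℕ) → ℕ
total zero F = F []
total {p} (suc n) F = sumFin {p} (λ x → total n (λ c → F (x ∷ c)))

total-cong : ∀ {p} n {F H : Vec (Fin p) n → ℕ} → (∀ c → F c ≡ H c) → total n F ≡ total n H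
total-cong zero e = e []
total-cong (suc n) e = sum-cong (λ x → total-cong n (λ c → e (x ∷ c)))

total-mono : ∀ {p} n {F H : Vec (Fin p) n → ℕ} → (∀ c → F c ≤ H c) → total n F ≤ total n H
total-mono zero e = e []
total-mono (suc n) e = sum-mono (λ x → total-mono n (λ c → e (x ∷ c)))

total-+ : ∀ {p} n (F H : Vec (Fin p) n → ℕ) → total n (λ c → F c + H c) ≡ total n F + total n H
total-+ zero F H = refl
total-+ (suc n) F H = trans (sum-cong (λ x → total-+ n (λ c → F (x ∷ c)) (λ c → H (x ∷ c))))
  (sum-+ (λ x → total n (λ c → F (x ∷ c))) (λ x → total n (λ c → H (x ∷ c))))

total-*ˡ : ∀ {p} n k (F : Vec (Fin p) n → ℕ) → total n (λ c → k * F c) ≡ k * total n F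
total-*ˡ zero k F = refl
total-*ˡ (suc n) k F = trans (sum-cong (λ x → total-*ˡ n k (λ c → F (x ∷ c))))
  (sum-*ˡ k (λ x → total n (λ c → F (x ∷ c))))

total-*ʳ : ∀ {p} n k (F : Vec (Fin p) n → ℕ) → total n (λ c → F c * k) ≡ total n F * k
total-*ʳ n k F = trans (total-cong n (λ c → *-comm (F c) k)) (trans (total-*ˡ n k F) (*-comm k _))

total-sum : ∀ {p} n {m} (F : Fin m → Vec (Fin p) n → ℕ) →
  total n (λ c → sumFin (λ i → F i c)) ≡ sumFin (λ i → total n (F i))
total-sum zero F = refl
total-sum (suc n) F = trans (sum-cong (λ x → total-sum n (λ i c → F i (x ∷ c))))
  (sum-swap (λ x i → total n (λ c → F i (x ∷ c))))

total-1 : ∀ p n → total {p} n (λ _ → 1) ≡ p ^ n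
total-1 p zero = refl
total-1 p (suc n) = trans (sum-const p _) (cong (p *_) (total-1 p n))

total-pos : ∀ {p} n (F : Vec (Fin p) n → ℕ) → 0 < total n F → ∃ λ c → 0 < F c
total-pos zero F l = [] , l
total-pos (suc n) F l with sum-pos (λ x → total n (λ c → F (x ∷ c))) l
... | x , l' with total-pos n (λ c → F (x ∷ c)) l'
...   | c , l″ = x ∷ c , l″

DependsOn : ∀ {p n} {X : Set} → (Fin n → Bool) → (Vec (Fin p) n → X) → Set
DependsOn S f = ∀ c c' → (∀ k → S k ≡ true → lookup c k ≡ lookup c' k) → f c ≡ f c'

head-free : ∀ {p} n (f g : Vec (Fin p) (suc n) → ℕ) → (∀ x y c → g (x ∷ c) ≡ g (y ∷ c)) →
  (∀ x → total n (λ c → f (x ∷ c) * g (x ∷ c)) * p ^ n ≡ total n (λ c → f (x ∷ c)) * total n (λ c → g (x ∷ c))) →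
  total (suc n) (λ c → f c * g c) * p ^ suc n ≡ total (suc n) f * total (suc n) g
head-free {zero} n f g free ih = refl
head-free {suc p} n f g free ih = begin
  sumFin fg * (suc p * suc p ^ n) ≡⟨ l (sumFin fg) (suc p) (suc p ^ n) ⟩
  sumFin fg * suc p ^ n * suc p ≡⟨ cong (_* suc p) (sym (sum-*ʳ (suc p ^ n) fg)) ⟩
  sumFin (λ x → fg x * suc p ^ n) * suc p ≡⟨ cong (_* suc p) (sum-cong (λ x → trans (ih x) (cong (fs x *_) (g≡ x)))) ⟩
  sumFin (λ x → fs x * g₀) * suc p ≡⟨ cong (_* suc p) (sum-*ʳ g₀ fs) ⟩
  sumFin fs * g₀ * suc p ≡⟨ l′ (sumFin fs) g₀ (suc p) ⟩
  sumFin fs * (suc p * g₀) ≡⟨ cong (sumFin fs *_) (sym (trans (sum-cong g≡) (sum-const (suc p) g₀))) ⟩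
  sumFin fs * sumFin (λ x → total n (λ c → g (x ∷ c))) ∎
  where
  open ≡-Reasoning
  fg fs : Fin (suc p) → ℕ
  fg x = total n (λ c → f (x ∷ c) * g (x ∷ c))
  fs x = total n (λ c → f (x ∷ c))
  g₀ = total n (λ c → g (zero ∷ c))
  g≡ : ∀ x → total n (λ c → g (x ∷ c)) ≡ g₀
  g≡ x = total-cong n (free x zero)
  l : ∀ a b c → a * (b * c) ≡ a * c * b
  l = solve-∀
  l′ : ∀ a b c → a * b * c ≡ a * (c * b)
  l′ = solve-∀

-- The product rule for expectations over disjoint sets of coordinates, multiplied through by
-- `p ^ n` twice. The first coordinate is invisible to `f` or to `g`, and `head-free` pulls that
-- factor out of the sum over it.
independence : ∀ {p} n (S : Fin n → Bool) (f g : Vec (Fin p) n → ℕ) →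
  DependsOn S f → DependsOn (not ∘ S) g →
  total n (λ c → f c * g c) * p ^ n ≡ total n f * total n g
independence zero S f g _ _ = *-identityʳ _
independence {p} (suc n) S f g df dg = by-head (S zero) refl
  where
  ih : ∀ x → total n (λ c → f (x ∷ c) * g (x ∷ c)) * p ^ n ≡ total n (λ c → f (x ∷ c)) * total n (λ c → g (x ∷ c))
  ih x = independence n (S ∘ suc) (λ c → f (x ∷ c)) (λ c → g (x ∷ c))
    (λ c c' e → df _ _ (λ { zero _ → refl ; (suc k) → e k }))
    (λ c c' e → dg _ _ (λ { zero _ → refl ; (suc k) → e k }))
  by-head : ∀ b → S zero ≡ b → total (suc n) (λ c → f c * g c) * p ^ suc n ≡ total (suc n) f * total (suc n) g
  by-head true e = head-free n f g
    (λ x y c → dg _ _ (λ { zero q → ⊥-elim (true≢false q (cong not e)) ; (suc k) _ → refl })) ih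
  by-head false e = begin
    total (suc n) (λ c → f c * g c) * p ^ suc n ≡⟨ cong (_* p ^ suc n) (total-cong (suc n) (λ c → *-comm (f c) (g c))) ⟩
    total (suc n) (λ c → g c * f c) * p ^ suc n ≡⟨ head-free n g f
      (λ x y c → df _ _ (λ { zero q → ⊥-elim (true≢false q e) ; (suc k) _ → refl }))
      (λ x → trans (cong (_* p ^ n) (total-cong n (λ c → *-comm (g (x ∷ c)) (f (x ∷ c))))) (trans (ih x) (*-comm (total n (λ c → f (x ∷ c))) _))) ⟩
    total (suc n) g * total (suc n) f ≡⟨ *-comm (total (suc n) g) _ ⟩
    total (suc n) f * total (suc n) g ∎
    where open ≡-Reasoning

sumList : ∀ {I : Set} → (I → ℕ) → List I → ℕ
sumList f [] = 0
sumList f (j ∷ J) = f j + sumList f J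

sumList-allFin : ∀ {m} (f : Fin m → ℕ) → sumList f (allFin m) ≡ sumFin f
sumList-allFin {m} f = go m (λ i → i)
  where
  go : ∀ k (h : Fin k → Fin m) → sumList f (tabulate h) ≡ sumFin (f ∘ h)
  go zero h = refl
  go (suc k) h = cong (f (h zero) +_) (go k (h ∘ suc))

keep : ∀ {I : Set} → (I → Bool) → List I → List I
keep q [] = []
keep q (j ∷ J) = if q j then j ∷ keep q J else keep q J

module LocalLemma {p n} {I : Set} (0<p : 0 < p) (B : I → Vec (Fin p) n → Bool) (S : I → Fin n → Bool)
  (dep : ∀ i → DependsOn (S i) (B i)) (D : ℕ) (0<D : 0 < D)
  (rare : ∀ i → 4 * D * total n (λ c → 𝟙 (B i c)) ≤ p ^ n) where

  0<pⁿ : 0 < p ^ n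
  0<pⁿ = m^n>0 p {{>-nonZero 0<p}} n

  meets : I → I → Bool
  meets i j = does (any? (λ k → (S i k ∧ S j k) Data.Bool.≟ true))

  meets-sum : ∀ i j → 𝟙 (meets i j) ≤ sumFin (λ k → 𝟙 (S i k) * 𝟙 (S j k))
  meets-sum i j with any? (λ k → (S i k ∧ S j k) Data.Bool.≟ true)
  ... | no _ = z≤n
  ... | yes (k , m) = ≤-trans (≤-reflexive (sym (trans (sym (𝟙-∧ (S i k) (S j k))) (cong 𝟙 m))))
                              (sum-∋ (λ k → 𝟙 (S i k) * 𝟙 (S j k)) k)

  far : I → List I → List I
  far i = keep (λ j → not (meets i j))

  nearSum : I → (I → ℕ) → List I → ℕ
  nearSum i x = sumList (λ j → 𝟙 (meets i j) * x j)

  Sparse : List I → Set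
  Sparse J = ∀ i → nearSum i (λ _ → 1) J ≤ D

  sumList-filter : ∀ (f : I → ℕ) q J → sumList f (keep q J) ≤ sumList f J
  sumList-filter f q [] = z≤n
  sumList-filter f q (j ∷ J) with q j
  ... | true = +-monoʳ-≤ (f j) (sumList-filter f q J)
  ... | false = ≤-trans (sumList-filter f q J) (m≤n+m _ (f j))

  good : List I → Vec (Fin p) n → Bool
  good [] c = true
  good (j ∷ J) c = not (B j c) ∧ good J c

  N : List I → ℕ
  N J = total n (λ c → 𝟙 (good J c))

  NB : I → List I → ℕ
  NB i J = total n (λ c → 𝟙 (B i c) * 𝟙 (good J c))

  good-far : ∀ i J c → 𝟙 (good J c) ≤ 𝟙 (good (far i J) c)
  good-far i [] c = ≤-refl
  good-far i (j ∷ J) c with meets i j | B j c in e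
  ... | true | true = z≤n
  ... | true | false = good-far i J c
  ... | false | true rewrite e = z≤n
  ... | false | false rewrite e = good-far i J c

  far-good : ∀ i J c → 𝟙 (good (far i J) c) ≤ 𝟙 (good J c) + nearSum i (λ j → 𝟙 (B j c)) J
  far-good i [] c = ≤-refl
  far-good i (j ∷ J) c with meets i j | B j c in e
  ... | true | true = ≤-trans (𝟙≤1 _) (m≤m+n 1 _)
  ... | true | false = far-good i J c
  ... | false | true rewrite e = z≤n
  ... | false | false rewrite e = far-good i J c

  nearSum-cong : ∀ i {x y : I → ℕ} J → (∀ j → x j ≡ y j) → nearSum i x J ≡ nearSum i y J
  nearSum-cong i [] e = refl
  nearSum-cong i (j ∷ J) e = cong₂ _+_ (cong (𝟙 (meets i j) *_) (e j)) (nearSum-cong i J e)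

  total-nearSum : ∀ i (x : I → Vec (Fin p) n → ℕ) J →
    total n (λ c → nearSum i (λ j → x j c) J) ≡ nearSum i (λ j → total n (x j)) J
  total-nearSum i x [] = trans (total-*ˡ n 0 (λ _ → 0)) refl
  total-nearSum i x (j ∷ J) = trans (total-+ n _ _)
    (cong₂ _+_ (total-*ˡ n (𝟙 (meets i j)) (x j)) (total-nearSum i x J))

  -- Union bound: an outcome that avoids the far events but not all of `J` lies in some near event,
  -- and still avoids the far ones.
  N-far : ∀ i J → N (far i J) ≤ N J + nearSum i (λ j → NB j (far i J)) J
  N-far i J = begin
    N (far i J) ≤⟨ total-mono n pt ⟩
    total n (λ c → 𝟙 (good J c) + nearSum i (λ j → 𝟙 (B j c) * 𝟙 (good (far i J) c)) J) ≡⟨ total-+ n _ _ ⟩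
    N J + total n (λ c → nearSum i (λ j → 𝟙 (B j c) * 𝟙 (good (far i J) c)) J) ≡⟨ cong (N J +_) (total-nearSum i (λ j c → 𝟙 (B j c) * 𝟙 (good (far i J) c)) J) ⟩
    N J + nearSum i (λ j → NB j (far i J)) J ∎
    where
    open ≤-Reasoning
    pt : ∀ c → 𝟙 (good (far i J) c) ≤ 𝟙 (good J c) + nearSum i (λ j → 𝟙 (B j c) * 𝟙 (good (far i J) c)) J
    pt c with good (far i J) c | far-good i J c
    ... | false | _ = z≤n
    ... | true | l = ≤-trans l (+-monoʳ-≤ (𝟙 (good J c)) (≤-reflexive (nearSum-cong i J (λ j → sym (*-identityʳ _)))))

  -- This dichotomy keeps the induction on length going: if nothing was removed, no event of `J` is
  -- near and the sum to be bounded vanishes.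
  far-shrinks : ∀ i J → length (far i J) ≤ length J ×
    (length (far i J) < length J ⊎ (∀ x → nearSum i x J ≡ 0))
  far-shrinks i [] = z≤n , inj₂ (λ _ → refl)
  far-shrinks i (j ∷ J) with meets i j | far-shrinks i J
  ... | true | l , _ = m≤n⇒m≤1+n l , inj₁ (s≤s l)
  ... | false | l , inj₁ l' = s≤s l , inj₁ (s≤s l')
  ... | false | l , inj₂ z = s≤s l , inj₂ z

  nearSum-bound : ∀ i (x : I → ℕ) k M J → (∀ j → k * x j ≤ M) → k * nearSum i x J ≤ nearSum i (λ _ → 1) J * M
  nearSum-bound i x k M [] h = ≤-reflexive (*-zeroʳ k)
  nearSum-bound i x k M (j ∷ J) h = begin
    k * (m * x j + nearSum i x J) ≡⟨ l k m (x j) _ ⟩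
    m * (k * x j) + k * nearSum i x J ≤⟨ +-mono-≤ (*-monoʳ-≤ m (h j)) (nearSum-bound i x k M J h) ⟩
    m * M + nearSum i (λ _ → 1) J * M ≡⟨ l′ m M _ ⟩
    (m * 1 + nearSum i (λ _ → 1) J) * M ∎
    where
    open ≤-Reasoning
    m = 𝟙 (meets i j)
    l : ∀ k m x s → k * (m * x + s) ≡ m * (k * x) + k * s
    l = solve-∀
    l′ : ∀ m M s → m * M + s * M ≡ (m * 1 + s) * M
    l′ = solve-∀

  dep-far : ∀ i J → DependsOn (not ∘ S i) (λ c → 𝟙 (good (far i J) c))
  dep-far i J c c' e = cong 𝟙 (go J)
    where
    disjoint : ∀ j → meets i j ≡ false → ∀ k → S j k ≡ true → lookup c k ≡ lookup c' k
    disjoint j m k Sjk = e k (cong not (contra (λ Sik →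
      dec-true (any? (λ k → (S i k ∧ S j k) Data.Bool.≟ true)) (k , ∧-true Sik Sjk)) m))
    go : ∀ J → good (far i J) c ≡ good (far i J) c'
    go [] = refl
    go (j ∷ J) with meets i j in m
    ... | true = go J
    ... | false = cong₂ (λ a b → not a ∧ b) (dep j c c' (disjoint j m)) (go J)

  NB-far : ∀ i J → 4 * D * NB i (far i J) ≤ N (far i J)
  NB-far i J = *-cancelʳ-≤ _ _ (p ^ n) {{>-nonZero 0<pⁿ}} (begin
    4 * D * NB i (far i J) * p ^ n ≡⟨ *-assoc (4 * D) _ _ ⟩
    4 * D * (NB i (far i J) * p ^ n) ≡⟨ cong (4 * D *_) (independence n (S i) (λ c → 𝟙 (B i c)) (λ c → 𝟙 (good (far i J) c)) (λ c c' e → cong 𝟙 (dep i c c' e)) (dep-far i J)) ⟩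
    4 * D * (total n (λ c → 𝟙 (B i c)) * N (far i J)) ≡⟨ *-assoc (4 * D) _ _ ⟨
    4 * D * total n (λ c → 𝟙 (B i c)) * N (far i J) ≤⟨ *-monoˡ-≤ (N (far i J)) (rare i) ⟩
    p ^ n * N (far i J) ≡⟨ *-comm (p ^ n) _ ⟩
    N (far i J) * p ^ n ∎)
    where open ≤-Reasoning

  -- Pr (B i | good J) ≤ 1/(2D): condition first on the events independent of B i.
  conditional : ∀ k J → length J ≤ k → Sparse J → ∀ i → 2 * D * NB i J ≤ N J
  conditional k J len sparse i = *-cancelˡ-≤ 2 (begin
    2 * (2 * D * NB i J) ≡⟨ l D (NB i J) ⟩
    4 * D * NB i J ≤⟨ *-monoʳ-≤ (4 * D) (total-mono n (λ c → *-monoʳ-≤ (𝟙 (B i c)) (good-far i J c))) ⟩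
    4 * D * NB i (far i J) ≤⟨ NB-far i J ⟩
    N (far i J) ≤⟨ half ⟩
    2 * N J ∎)
    where
    open ≤-Reasoning
    l : ∀ D x → 2 * (2 * D * x) ≡ 4 * D * x
    l = solve-∀
    near : ∀ k → length J ≤ k → (length (far i J) < length J ⊎ (∀ x → nearSum i x J ≡ 0)) →
      2 * nearSum i (λ j → NB j (far i J)) J ≤ N (far i J)
    near _ _ (inj₂ z) rewrite z (λ j → NB j (far i J)) = z≤n
    near zero len (inj₁ s) = contradiction (<-≤-trans s len) λ ()
    -- Given the far events, each near event has probability at most 1/(2D) by induction, and there
    -- are at most `D` of them, so together they take at most half.
    near (suc k) len (inj₁ s) = *-cancelˡ-≤ D {{>-nonZero 0<D}} (begin
      D * (2 * X) ≡⟨ l″ D X ⟩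
      2 * D * X ≤⟨ nearSum-bound i (λ j → NB j (far i J)) (2 * D) (N (far i J)) J
                    (conditional k (far i J) (≤-pred (<-≤-trans s len)) (λ i' → ≤-trans (sumList-filter _ _ J) (sparse i'))) ⟩
      nearSum i (λ _ → 1) J * N (far i J) ≤⟨ *-monoˡ-≤ (N (far i J)) (sparse i) ⟩
      D * N (far i J) ∎)
      where
      X = nearSum i (λ j → NB j (far i J)) J
      l″ : ∀ D x → D * (2 * x) ≡ 2 * D * x
      l″ = solve-∀
    half : N (far i J) ≤ 2 * N J
    half = +-cancelʳ-≤ (N (far i J)) _ _ (begin
      F + F ≡⟨ cong (F +_) (sym (+-identityʳ F)) ⟩
      2 * F ≤⟨ *-monoʳ-≤ 2 (N-far i J) ⟩
      2 * (N J + X) ≡⟨ *-distribˡ-+ 2 (N J) X ⟩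
      2 * N J + 2 * X ≤⟨ +-monoʳ-≤ (2 * N J) (near k len (proj₂ (far-shrinks i J))) ⟩
      2 * N J + F ∎)
      where
      F = N (far i J)
      X = nearSum i (λ j → NB j (far i J)) J

  -- By `conditional`, each further event removes at most the fraction 1/(2D) ≤ 1/2 of a positive
  -- count.
  N-pos : ∀ J → Sparse J → 0 < N J
  N-pos [] _ = subst (0 <_) (sym (total-1 p n)) 0<pⁿ
  N-pos (j ∷ J) sparse = positive (N-pos J sparse') (conditional _ J ≤-refl sparse' j) split'
    where
    sparse' : Sparse J
    sparse' i = ≤-trans (m≤n+m _ (𝟙 (meets i j) * 1)) (sparse i)
    split' : N J ≡ N (j ∷ J) + NB j J
    split' = trans (total-cong n pt) (total-+ n _ _)
      where
      pt : ∀ c → 𝟙 (good J c) ≡ 𝟙 (good (j ∷ J) c) + 𝟙 (B j c) * 𝟙 (good J c)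
      pt c with B j c
      ... | true = sym (+-identityʳ _)
      ... | false = sym (+-identityʳ _)
    positive : 0 < N J → 2 * D * NB j J ≤ N J → N J ≡ N (j ∷ J) + NB j J → 0 < N (j ∷ J)
    positive pos le e with N (j ∷ J)
    ... | suc _ = s≤s z≤n
    ... | zero = contradiction (begin-strict
      NB j J <⟨ m<n+m (NB j J) (subst (0 <_) e pos) ⟩
      NB j J + NB j J ≡⟨ cong (NB j J +_) (sym (+-identityʳ _)) ⟩
      2 * NB j J ≤⟨ *-monoˡ-≤ (NB j J) (*-monoʳ-≤ 2 0<D) ⟩
      2 * D * NB j J ≤⟨ le ⟩
      N J ≡⟨ e ⟩
      NB j J ∎) (n≮n _)
      where open ≤-Reasoning

  avoid : ∀ J → Sparse J → ∃ λ c → ∀ j → j ∈ J → B j c ≡ false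
  avoid J sparse with total-pos n (λ c → 𝟙 (good J c)) (N-pos J sparse)
  ... | c , l = c , all-good J (pos→true l)
    where
    pos→true : ∀ {b} → 0 < 𝟙 b → b ≡ true
    pos→true {true} _ = refl
    all-good : ∀ J → good J c ≡ true → ∀ j → j ∈ J → B j c ≡ false
    all-good (j ∷ J) g .j (here refl) = not-true (∧-trueˡ g)
    all-good (j ∷ J) g i (there i∈) = all-good J (∧-trueʳ {not (B j c)} g) i i∈

-- A Chernoff bound, by counting

-- Bernoulli's inequality 1 - j/(x+1) ≤ (1 - 1/(x+1))^j, cleared of denominators; `m` stands for x +
-- 1 - j.
bernoulli : ∀ x j m → j + m ≡ suc x → suc x ^ j * m ≤ x ^ j * suc x
bernoulli x zero m e = ≤-reflexive (cong (1 *_) e)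
bernoulli zero (suc zero) m refl = z≤n
bernoulli zero (suc (suc j)) m ()
bernoulli x@(suc x') (suc j) m e = *-cancelˡ-≤ (suc m) (begin
  suc m * (suc x ^ suc j * m) ≡⟨ l (suc m) (suc x) (suc x ^ j) m ⟩
  (suc x ^ j * suc m) * (suc x * m) ≤⟨ *-mono-≤ (bernoulli x j (suc m) (trans (+-suc j m) e)) xm ⟩
  (x ^ j * suc x) * (x * suc m) ≡⟨ l′ (x ^ j) (suc x) x (suc m) ⟩
  suc m * (x ^ suc j * suc x) ∎)
  where
  open ≤-Reasoning
  l : ∀ a b c d → a * (b * c * d) ≡ (c * a) * (b * d)
  l = solve-∀
  l′ : ∀ a b c d → (a * b) * (c * d) ≡ d * (c * a * b)
  l′ = solve-∀
  m≤x : m ≤ x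
  m≤x = ≤-trans (m≤n+m m j) (≤-reflexive (suc-injective e))
  xm : suc x * m ≤ x * suc m
  xm = ≤-trans (+-monoˡ-≤ (x * m) m≤x) (≤-reflexive (sym (*-suc x m)))

^-distribʳ-* : ∀ k m n → (m * n) ^ k ≡ m ^ k * n ^ k
^-distribʳ-* zero m n = refl
^-distribʳ-* (suc k) m n = trans (cong (m * n *_) (^-distribʳ-* k m n)) (l m n (m ^ k) (n ^ k))
  where
  l : ∀ a b c d → a * b * (c * d) ≡ a * c * (b * d)
  l = solve-∀

-- In fractions, (1 + 1/(pq))^p ≤ q/r. Bernoulli with `x = p * q` and `j = p` has m = pr + 1, and
-- (pq + 1)/(pr + 1) lies just below q/r.
power-ratio : ∀ p r → let q = suc r in suc (p * q) ^ p * r ≤ (p * q) ^ p * q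
power-ratio p r = *-cancelʳ-≤ _ _ (suc (p * r)) (begin
  suc x ^ p * r * suc (p * r) ≡⟨ l (suc x ^ p) r (suc (p * r)) ⟩
  r * (suc x ^ p * suc (p * r)) ≤⟨ *-monoʳ-≤ r (bernoulli x p (suc (p * r)) (l′ p r)) ⟩
  r * (x ^ p * suc x) ≡⟨ l″ r (x ^ p) (suc x) ⟩
  x ^ p * (r * suc x) ≤⟨ *-monoʳ-≤ (x ^ p) (≤-trans (m≤m+n _ 1) (≤-reflexive (l‴ p r))) ⟩
  x ^ p * (suc r * suc (p * r)) ≡⟨ *-assoc (x ^ p) (suc r) (suc (p * r)) ⟨
  x ^ p * suc r * suc (p * r) ∎)
  where
  open ≤-Reasoning
  x = p * suc r
  l : ∀ a b c → a * b * c ≡ b * (a * c)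
  l = solve-∀
  l′ : ∀ p r → p + suc (p * r) ≡ suc (p * suc r)
  l′ = solve-∀
  l″ : ∀ a b c → a * (b * c) ≡ b * (a * c)
  l″ = solve-∀
  l‴ : ∀ p r → r * suc (p * suc r) + 1 ≡ suc r * suc (p * r)
  l‴ = solve-∀

-- (1 + 1/r)^r ≤ (1 + 1/q)^q for q = r + 1, cleared of denominators.
euler-mono : ∀ r → let q = suc r in q ^ r * q ^ q ≤ suc q ^ q * r ^ r
euler-mono r = *-cancelʳ-≤ _ _ (q * q) (begin
  q ^ r * q ^ q * (q * q) ≡⟨ l (q ^ r) q ⟩
  q ^ r * q ^ r * (q * (q * q)) ≤⟨ *-monoʳ-≤ (q ^ r * q ^ r) (≤-trans (m≤m+n _ 1) (≤-reflexive (l′ r))) ⟩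
  q ^ r * q ^ r * (suc q * m) ≡⟨ cong (_* (suc q * m)) (sym (^-distribʳ-* r q q)) ⟩
  (q * q) ^ r * (suc q * m) ≡⟨ l″ ((q * q) ^ r) (suc q) m ⟩
  suc q * ((q * q) ^ r * m) ≤⟨ *-monoʳ-≤ (suc q) (subst (λ z → z ^ r * m ≤ (suc q * r) ^ r * z) (sym q²) (bernoulli (suc q * r) r m (l‴ r))) ⟩
  suc q * ((suc q * r) ^ r * (q * q)) ≡⟨ cong (λ z → suc q * (z * (q * q))) (^-distribʳ-* r (suc q) r) ⟩
  suc q * (suc q ^ r * r ^ r * (q * q)) ≡⟨ l⁗ (suc q) (suc q ^ r) (r ^ r) (q * q) ⟩
  suc q ^ q * r ^ r * (q * q) ∎)
  where
  open ≤-Reasoning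
  q = suc r
  m = r * r + r + 1
  q² : q * q ≡ suc (suc q * r)
  q² = e r
    where
    e : ∀ r → suc r * suc r ≡ suc (suc (suc r) * r)
    e = solve-∀
  l : ∀ a q → a * (q * a) * (q * q) ≡ a * a * (q * (q * q))
  l = solve-∀
  l′ : ∀ r → suc r * (suc r * suc r) + 1 ≡ suc (suc r) * (r * r + r + 1)
  l′ = solve-∀
  l″ : ∀ a b c → a * (b * c) ≡ b * (a * c)
  l″ = solve-∀
  l‴ : ∀ r → r + (r * r + r + 1) ≡ suc (suc (suc r) * r)
  l‴ = solve-∀
  l⁗ : ∀ a b c d → a * (b * c * d) ≡ a * b * c * d
  l⁗ = solve-∀

growth : ∀ q j → q ^ j * (q + j) ≤ suc q ^ j * q
growth q zero = ≤-reflexive (cong (1 *_) (+-identityʳ q))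
growth q (suc j) = begin
  q * q ^ j * (q + suc j) ≡⟨ l q (q ^ j) j ⟩
  q ^ j * (q * (q + suc j)) ≤⟨ *-monoʳ-≤ (q ^ j) (≤-trans (m≤m+n _ j) (≤-reflexive (l′ q j))) ⟩
  q ^ j * (suc q * (q + j)) ≡⟨ l″ (q ^ j) (suc q) (q + j) ⟩
  suc q * (q ^ j * (q + j)) ≤⟨ *-monoʳ-≤ (suc q) (growth q j) ⟩
  suc q * (suc q ^ j * q) ≡⟨ *-assoc (suc q) (suc q ^ j) q ⟨
  suc q ^ suc j * q ∎
  where
  open ≤-Reasoning
  l : ∀ q a j → q * a * (q + suc j) ≡ a * (q * (q + suc j))
  l = solve-∀
  l′ : ∀ q j → q * (q + suc j) + j ≡ suc q * (q + j)
  l′ = solve-∀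
  l″ : ∀ a b c → a * (b * c) ≡ b * (a * c)
  l″ = solve-∀

doubling : ∀ r → let q = suc r in 2 * q ^ q ≤ suc q ^ q
doubling r = *-cancelʳ-≤ _ _ q (≤-trans (≤-reflexive (l q (q ^ q))) (growth q q))
  where
  q = suc r
  l : ∀ q a → 2 * a * q ≡ a * (q + q)
  l = solve-∀

-- The exponential moment (1 + 1/(pq))^(prM) of `p * (r * M)` trials is at most (q/r)^(rM) by
-- `power-ratio`, hence at most (1 + 1/q)^(qM) by `euler-mono`.
tail-ratio : ∀ p r M → 0 < r → let q = suc r in
  suc (p * q) ^ (p * (r * M)) * q ^ (q * M) ≤ (p * q) ^ (p * (r * M)) * suc q ^ (q * M)
tail-ratio p r M 0<r = *-cancelʳ-≤ _ _ (r ^ R) {{>-nonZero (m^n>0 r {{>-nonZero 0<r}} R)}} (begin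
  suc x ^ (p * R) * q ^ (q * M) * r ^ R ≡⟨ l (suc x ^ (p * R)) (q ^ (q * M)) (r ^ R) ⟩
  suc x ^ (p * R) * r ^ R * q ^ (q * M) ≤⟨ *-monoˡ-≤ (q ^ (q * M)) ratio ⟩
  x ^ (p * R) * q ^ R * q ^ (q * M) ≡⟨ *-assoc (x ^ (p * R)) _ _ ⟩
  x ^ (p * R) * (q ^ R * q ^ (q * M)) ≤⟨ *-monoʳ-≤ (x ^ (p * R)) euler ⟩
  x ^ (p * R) * (suc q ^ (q * M) * r ^ R) ≡⟨ *-assoc (x ^ (p * R)) _ _ ⟨
  x ^ (p * R) * suc q ^ (q * M) * r ^ R ∎)
  where
  open ≤-Reasoning
  q = suc r
  x = p * q
  R = r * M
  l : ∀ a b c → a * b * c ≡ a * c * b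
  l = solve-∀
  ratio : suc x ^ (p * R) * r ^ R ≤ x ^ (p * R) * q ^ R
  ratio = begin
    suc x ^ (p * R) * r ^ R ≡⟨ cong (_* r ^ R) (^-*-assoc (suc x) p R) ⟨
    (suc x ^ p) ^ R * r ^ R ≡⟨ ^-distribʳ-* R (suc x ^ p) r ⟨
    (suc x ^ p * r) ^ R ≤⟨ ^-monoˡ-≤ R (power-ratio p r) ⟩
    (x ^ p * q) ^ R ≡⟨ ^-distribʳ-* R (x ^ p) q ⟩
    (x ^ p) ^ R * q ^ R ≡⟨ cong (_* q ^ R) (^-*-assoc x p R) ⟩
    x ^ (p * R) * q ^ R ∎
  euler : q ^ R * q ^ (q * M) ≤ suc q ^ (q * M) * r ^ R
  euler = begin
    q ^ R * q ^ (q * M) ≡⟨ cong₂ _*_ (^-*-assoc q r M) (^-*-assoc q q M) ⟨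
    (q ^ r) ^ M * (q ^ q) ^ M ≡⟨ ^-distribʳ-* M (q ^ r) (q ^ q) ⟨
    (q ^ r * q ^ q) ^ M ≤⟨ ^-monoˡ-≤ M (euler-mono r) ⟩
    (suc q ^ q * r ^ r) ^ M ≡⟨ ^-distribʳ-* M (suc q ^ q) (r ^ r) ⟩
    (suc q ^ q) ^ M * (r ^ r) ^ M ≡⟨ cong₂ _*_ (^-*-assoc (suc q) q M) (^-*-assoc r r M) ⟩
    suc q ^ (q * M) * r ^ R ∎

module Tail {p} (y : Fin p) (q : ℕ) (0<q : 0 < q) where

  hits : ∀ {n} → (Fin n → Bool) → Vec (Fin p) n → ℕ
  hits T c = sumFin (λ u → 𝟙 (T u ∧ eqᵇ (lookup c u) y))

  -- The exponential moment (1 + 1/q)^hits, scaled by q^|T|.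
  weight : ∀ {n} → (Fin n → Bool) → Vec (Fin p) n → ℕ
  weight T [] = 1
  weight T (x ∷ c) = (if T zero then q + 𝟙 (eqᵇ x y) else 1) * weight (T ∘ suc) c

  weight-hits : ∀ {n} (T : Fin n → Bool) c → weight T c * q ^ hits T c ≡ suc q ^ hits T c * q ^ count T
  weight-hits T [] = refl
  weight-hits T (x ∷ c) with T zero | eqᵇ x y | weight-hits (T ∘ suc) c
  ... | true | true | ih = trans (l (q + 1) _ q _) (trans (cong₂ _*_ (l′ q) ih) (l″ (suc q) q (suc q ^ H) (q ^ K)))
    where
    H = hits (T ∘ suc) c
    K = count (T ∘ suc)
    l : ∀ a w q h → a * w * (q * h) ≡ a * q * (w * h)
    l = solve-∀
    l′ : ∀ q → (q + 1) * q ≡ suc q * q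
    l′ = solve-∀
    l″ : ∀ s q a b → s * q * (a * b) ≡ s * a * (q * b)
    l″ = solve-∀
  ... | true | false | ih = trans (l q _ _) (trans (cong (q *_) ih) (l′ q (suc q ^ hits (T ∘ suc) c) (q ^ count (T ∘ suc))))
    where
    l : ∀ q w h → (q + 0) * w * h ≡ q * (w * h)
    l = solve-∀
    l′ : ∀ q a b → q * (a * b) ≡ a * (q * b)
    l′ = solve-∀
  ... | false | _ | ih = trans (cong (_* q ^ hits (T ∘ suc) c) (*-identityˡ (weight (T ∘ suc) c))) ih

  -- Coordinates are independent: one in `T` contributes the factor pq + 1, namely `q` for each of
  -- the `p` colours and 1 more for `y`; any other contributes `p`.
  total-weight : ∀ n (T : Fin n → Bool) → total n (weight T) * p ^ count T ≡ suc (p * q) ^ count T * p ^ n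
  total-weight zero T = refl
  total-weight (suc n) T = trans (cong (_* p ^ count T) head) (step′ (T zero) refl)
    where
    w : Fin p → ℕ
    w x = if T zero then q + 𝟙 (eqᵇ x y) else 1
    W = total n (weight (T ∘ suc))
    head : total (suc n) (weight T) ≡ sumFin w * W
    head = trans (sum-cong (λ x → total-*ˡ n (w x) (weight (T ∘ suc)))) (sum-*ʳ W w)
    K = count (T ∘ suc)
    step′ : ∀ b → T zero ≡ b → sumFin w * W * p ^ (𝟙 (T zero) + K) ≡ suc (p * q) ^ (𝟙 (T zero) + K) * p ^ suc n
    step′ true e rewrite e | sum-+ {p} (λ _ → q) (λ x → 𝟙 (eqᵇ x y)) | sum-const p q | sum-δ y =
      trans (l (p * q) W p (p ^ K)) (trans (cong (suc (p * q) * p *_) (total-weight n (T ∘ suc))) (l′ (suc (p * q)) p (suc (p * q) ^ K) (p ^ n)))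
      where
      l : ∀ a W p k → (a + 1) * W * (p * k) ≡ suc a * p * (W * k)
      l = solve-∀
      l′ : ∀ a p b c → a * p * (b * c) ≡ a * b * (p * c)
      l′ = solve-∀
    step′ false e rewrite e | sum-const p 1 =
      trans (l p W (p ^ K)) (trans (cong (p *_) (total-weight n (T ∘ suc))) (l′ p (suc (p * q) ^ K) (p ^ n)))
      where
      l : ∀ p W k → p * 1 * W * k ≡ p * (W * k)
      l = solve-∀
      l′ : ∀ p b c → p * (b * c) ≡ b * (p * c)
      l′ = solve-∀

  exceeds : ∀ {n} → (Fin n → Bool) → ℕ → Vec (Fin p) n → Bool
  exceeds T s c = does (s ≤? hits T c)

  q^-pos : ∀ k → 0 < q ^ k
  q^-pos k = m^n>0 q {{>-nonZero 0<q}} k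

  markov-pt : ∀ {n} (T : Fin n → Bool) s c →
    𝟙 (exceeds T s c) * (suc q ^ s * q ^ count T) ≤ weight T c * q ^ s
  markov-pt T s c with exceeds T s c in e
  ... | false = z≤n
  ... | true = ≤-trans (≤-reflexive (+-identityʳ _)) (*-cancelʳ-≤ _ _ (q ^ j) {{>-nonZero (q^-pos j)}} (begin
    suc q ^ s * q ^ count T * q ^ j ≡⟨ l₁ (suc q ^ s) (q ^ count T) (q ^ j) ⟩
    suc q ^ s * q ^ j * q ^ count T ≤⟨ *-monoˡ-≤ (q ^ count T) (*-monoʳ-≤ (suc q ^ s) (^-monoˡ-≤ j (n≤1+n q))) ⟩
    suc q ^ s * suc q ^ j * q ^ count T ≡⟨ cong (_* q ^ count T) (trans (sym (^-distribˡ-+-* (suc q) s j)) (cong (suc q ^_) s+j)) ⟩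
    suc q ^ hits T c * q ^ count T ≡⟨ weight-hits T c ⟨
    weight T c * q ^ hits T c ≡⟨ cong (weight T c *_) (trans (cong (q ^_) (sym s+j)) (^-distribˡ-+-* q s j)) ⟩
    weight T c * (q ^ s * q ^ j) ≡⟨ *-assoc (weight T c) _ _ ⟨
    weight T c * q ^ s * q ^ j ∎))
    where
    open ≤-Reasoning
    j = hits T c ∸ s
    s+j : s + j ≡ hits T c
    s+j = m+[n∸m]≡n (does-true (s ≤? hits T c) e)
    l₁ : ∀ a b c → a * b * c ≡ a * c * b
    l₁ = solve-∀

  bad : ∀ n → (Fin n → Bool) → ℕ → ℕ
  bad n T s = total n (λ c → 𝟙 (exceeds T s c))

  markov : ∀ n (T : Fin n → Bool) s →
    bad n T s * (suc q ^ s * (p * q) ^ count T) ≤ q ^ s * (suc (p * q) ^ count T * p ^ n)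
  markov n T s = begin
    b * (suc q ^ s * (p * q) ^ k) ≡⟨ cong (λ z → b * (suc q ^ s * z)) (^-distribʳ-* k p q) ⟩
    b * (suc q ^ s * (p ^ k * q ^ k)) ≡⟨ l b (suc q ^ s) (p ^ k) (q ^ k) ⟩
    b * (suc q ^ s * q ^ k) * p ^ k ≡⟨ cong (_* p ^ k) (total-*ʳ n (suc q ^ s * q ^ k) (λ c → 𝟙 (exceeds T s c))) ⟨
    total n (λ c → 𝟙 (exceeds T s c) * (suc q ^ s * q ^ k)) * p ^ k ≤⟨ *-monoˡ-≤ (p ^ k) (total-mono n (markov-pt T s)) ⟩
    total n (λ c → weight T c * q ^ s) * p ^ k ≡⟨ cong (_* p ^ k) (total-*ʳ n (q ^ s) (weight T)) ⟩
    total n (weight T) * q ^ s * p ^ k ≡⟨ l′ (total n (weight T)) (q ^ s) (p ^ k) ⟩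
    q ^ s * (total n (weight T) * p ^ k) ≡⟨ cong (q ^ s *_) (total-weight n T) ⟩
    q ^ s * (suc (p * q) ^ k * p ^ n) ∎
    where
    open ≤-Reasoning
    k = count T
    b = bad n T s
    l : ∀ b a c d → b * (a * (c * d)) ≡ b * (a * d) * c
    l = solve-∀
    l′ : ∀ a b c → a * b * c ≡ b * (a * c)
    l′ = solve-∀

  -- The moment factor 1 + 1/(pq) exceeds 1, so passing from `count T` to a larger `K` only weakens
  -- the bound.
  markov-≥ : ∀ n (T : Fin n → Bool) s K → count T ≤ K →
    bad n T s * (suc q ^ s * (p * q) ^ K) ≤ q ^ s * (suc (p * q) ^ K * p ^ n)
  markov-≥ n T s K le = begin
    b * (suc q ^ s * x ^ K) ≡⟨ cong (λ z → b * (suc q ^ s * z)) (split′ x) ⟩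
    b * (suc q ^ s * (x ^ k * x ^ j)) ≡⟨ l b (suc q ^ s) (x ^ k) (x ^ j) ⟩
    b * (suc q ^ s * x ^ k) * x ^ j ≤⟨ *-mono-≤ (markov n T s) (^-monoˡ-≤ j (n≤1+n x)) ⟩
    q ^ s * (suc x ^ k * p ^ n) * suc x ^ j ≡⟨ l′ (q ^ s) (suc x ^ k) (p ^ n) (suc x ^ j) ⟩
    q ^ s * (suc x ^ k * suc x ^ j * p ^ n) ≡⟨ cong (λ z → q ^ s * (z * p ^ n)) (sym (split′ (suc x))) ⟩
    q ^ s * (suc x ^ K * p ^ n) ∎
    where
    open ≤-Reasoning
    k = count T
    j = K ∸ k
    b = bad n T s
    x = p * q
    split′ : ∀ z → z ^ K ≡ z ^ k * z ^ j
    split′ z = trans (cong (z ^_) (sym (m+[n∸m]≡n le))) (^-distribˡ-+-* z k j)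
    l : ∀ b a c d → b * (a * (c * d)) ≡ b * (a * c) * d
    l = solve-∀
    l′ : ∀ a b c d → a * (b * c) * d ≡ a * (b * d * c)
    l′ = solve-∀

-- The mean is at most rM. Raising it to qM pays for the whole exponential moment (`tail-ratio`);
-- the remaining qΛ in `s` gives the probability (1 + 1/q)^(-qΛ), at most 2^(-Λ) by `doubling`.
tail-bound : ∀ {p} (y : Fin p) r → 0 < r → ∀ n (T : Fin n → Bool) M Λ s →
  count T ≤ p * (r * M) → s ≡ suc r * M + suc r * Λ →
  2 ^ Λ * total n (λ c → 𝟙 (Tail.exceeds y (suc r) (s≤s z≤n) T s c)) ≤ p ^ n
tail-bound {suc p'} y r 0<r n T M Λ s le refl =
  *-cancelʳ-≤ _ _ Z {{>-nonZero Z>0}} (begin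
    2 ^ Λ * b * Z ≡⟨ l₁ (2 ^ Λ) b (q ^ Δ) (suc q ^ E) (x ^ K) (q ^ E) ⟩
    2 ^ Λ * q ^ Δ * (suc q ^ E * (b * x ^ K * q ^ E)) ≤⟨ *-monoˡ-≤ _ double ⟩
    suc q ^ Δ * (suc q ^ E * (b * x ^ K * q ^ E)) ≡⟨ l₂ (suc q ^ Δ) (suc q ^ E) b (x ^ K) (q ^ E) ⟩
    b * (suc q ^ E * suc q ^ Δ * x ^ K) * q ^ E ≡⟨ cong (λ z → b * (z * x ^ K) * q ^ E) (^-distribˡ-+-* (suc q) E Δ) ⟨
    b * (suc q ^ s * x ^ K) * q ^ E ≤⟨ *-monoˡ-≤ (q ^ E) (markov-≥ n T s K le) ⟩
    q ^ s * (suc x ^ K * p ^ n) * q ^ E ≡⟨ l₃ (q ^ s) (suc x ^ K) (p ^ n) (q ^ E) ⟩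
    q ^ s * p ^ n * (suc x ^ K * q ^ E) ≤⟨ *-monoʳ-≤ (q ^ s * p ^ n) (tail-ratio p r M 0<r) ⟩
    q ^ s * p ^ n * (x ^ K * suc q ^ E) ≡⟨ cong (λ z → z * p ^ n * (x ^ K * suc q ^ E)) (^-distribˡ-+-* q E Δ) ⟩
    q ^ E * q ^ Δ * p ^ n * (x ^ K * suc q ^ E) ≡⟨ l₄ (q ^ E) (q ^ Δ) (p ^ n) (x ^ K) (suc q ^ E) ⟩
    p ^ n * Z ∎)
  where
  open ≤-Reasoning
  p = suc p'
  q = suc r
  open Tail y q (s≤s z≤n)
  x = p * q
  K = p * (r * M)
  E = q * M
  Δ = q * Λ
  b = bad n T s
  Z = q ^ Δ * (suc q ^ E * (x ^ K * q ^ E))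
  pos : ∀ z k → 0 < suc z ^ k
  pos z k = m^n>0 (suc z) k
  Z>0 : 0 < Z
  Z>0 = *-mono-≤ (pos r Δ) (*-mono-≤ (pos q E) (*-mono-≤ (pos _ K) (pos r E)))
  double : 2 ^ Λ * q ^ Δ ≤ suc q ^ Δ
  double = begin
    2 ^ Λ * q ^ Δ ≡⟨ cong (2 ^ Λ *_) (^-*-assoc q q Λ) ⟨
    2 ^ Λ * (q ^ q) ^ Λ ≡⟨ ^-distribʳ-* Λ 2 (q ^ q) ⟨
    (2 * q ^ q) ^ Λ ≤⟨ ^-monoˡ-≤ Λ (doubling r) ⟩
    (suc q ^ q) ^ Λ ≡⟨ ^-*-assoc (suc q) q Λ ⟩
    suc q ^ Δ ∎
  l₁ : ∀ a b c d e f → a * b * (c * (d * (e * f))) ≡ a * c * (d * (b * e * f))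
  l₁ = solve-∀
  l₂ : ∀ a d b e f → a * (d * (b * e * f)) ≡ b * (d * a * e) * f
  l₂ = solve-∀
  l₃ : ∀ a b c d → a * (b * c) * d ≡ a * c * (b * d)
  l₃ = solve-∀
  l₄ : ∀ a b c d e → a * b * c * (d * e) ≡ c * (b * (e * (d * a)))
  l₄ = solve-∀

-- Spreading the colours

anyᵇ : ∀ {m} → (Fin m → Bool) → Bool
anyᵇ {zero} P = false
anyᵇ {suc m} P = P zero ∨ anyᵇ (P ∘ suc)

anyᵇ-cong : ∀ {m} {P Q : Fin m → Bool} → (∀ i → P i ≡ Q i) → anyᵇ P ≡ anyᵇ Q
anyᵇ-cong {zero} e = refl
anyᵇ-cong {suc m} e = cong₂ _∨_ (e zero) (anyᵇ-cong (e ∘ suc))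

𝟙-∨ : ∀ a b → 𝟙 (a ∨ b) ≤ 𝟙 a + 𝟙 b
𝟙-∨ true b = s≤s z≤n
𝟙-∨ false b = ≤-refl

∨-falseˡ : ∀ {a b} → a ∨ b ≡ false → a ≡ false
∨-falseˡ {false} _ = refl

∨-falseʳ : ∀ {a b} → a ∨ b ≡ false → b ≡ false
∨-falseʳ {false} e = e

∨-trueˡ : ∀ {a b} → a ≡ true → a ∨ b ≡ true
∨-trueˡ refl = refl

∨-trueʳ : ∀ {a b} → b ≡ true → a ∨ b ≡ true
∨-trueʳ {true} _ = refl
∨-trueʳ {false} e = e

anyᵇ-false : ∀ {m} {P : Fin m → Bool} → anyᵇ P ≡ false → ∀ i → P i ≡ false
anyᵇ-false e zero = ∨-falseˡ e
anyᵇ-false {P = P} e (suc i) = anyᵇ-false (∨-falseʳ {P zero} e) i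

anyᵇ-sum : ∀ {m} (P : Fin m → Bool) → 𝟙 (anyᵇ P) ≤ sumFin (λ i → 𝟙 (P i))
anyᵇ-sum {zero} P = z≤n
anyᵇ-sum {suc m} P = ≤-trans (𝟙-∨ (P zero) _) (+-monoʳ-≤ (𝟙 (P zero)) (anyᵇ-sum (P ∘ suc)))

-- `B v` is a union of 2p tail events, each of probability at most 2^(-Λ). It depends only on the
-- colours of at most `K` neighbours, each lying in at most `K` supports, so `D = K * K` bounds the
-- dependencies, and `small` is the condition 4D · 2p ≤ 2^Λ.
module RandomColouring {n} (A : Digraph n) (g : Fin n → ℕ) (1≤g : ∀ v → 1 ≤ g v) (d K p r l Λ S : ℕ)
  (0<p : 0 < p) (0<r : 0 < r) (0<K : 0 < K)
  (out≤ : ∀ v → out A v ≤ d) (in≤ : ∀ v → in′ A v ≤ g v * d) (deg≤ : ∀ v → out A v + in′ A v ≤ K)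
  (d≤ : d ≤ p * (r * l)) (S≥ : suc r * (l + Λ) ≤ S) (small : 8 * (K * K) * p ≤ 2 ^ Λ) where

  q D s₁ : ℕ
  q = suc r
  D = K * K
  s₁ = q * l + q * Λ

  s₂ : Fin n → ℕ
  s₂ v = q * (l * g v) + q * Λ

  exceeds : Fin p → (Fin n → Bool) → ℕ → Vec (Fin p) n → Bool
  exceeds y = Tail.exceeds y q (s≤s z≤n)

  outBad inBad : Fin n → Fin p → Vec (Fin p) n → Bool
  outBad v y = exceeds y (A v) s₁
  inBad v y = exceeds y (λ u → A u v) (s₂ v)

  B : Fin n → Vec (Fin p) n → Bool
  B v c = anyᵇ (λ y → outBad v y c ∨ inBad v y c)

  supp : Fin n → Fin n → Bool
  supp v u = A v u ∨ A u v

  exceeds-dep : ∀ v y T s → (∀ u → T u ≡ true → supp v u ≡ true) → DependsOn (supp v) (exceeds y T s)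
  exceeds-dep v y T s sub c c' e = cong (λ k → does (s ≤? k)) (sum-cong pt)
    where
    pt : ∀ u → 𝟙 (T u ∧ eqᵇ (lookup c u) y) ≡ 𝟙 (T u ∧ eqᵇ (lookup c' u) y)
    pt u with T u in t
    ... | false = refl
    ... | true = cong (λ x → 𝟙 (eqᵇ x y)) (e u (sub u t))

  dep : ∀ v → DependsOn (supp v) (B v)
  dep v c c' e = anyᵇ-cong (λ y → cong₂ _∨_
    (exceeds-dep v y (A v) s₁ (λ u → ∨-trueˡ) c c' e)
    (exceeds-dep v y (λ u → A u v) (s₂ v) (λ u → ∨-trueʳ {A v u}) c c' e))

  outBad-rare : ∀ v y → 2 ^ Λ * total n (λ c → 𝟙 (outBad v y c)) ≤ p ^ n
  outBad-rare v y = tail-bound y r 0<r n (A v) l Λ s₁ (≤-trans (out≤ v) d≤) refl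

  inBad-rare : ∀ v y → 2 ^ Λ * total n (λ c → 𝟙 (inBad v y c)) ≤ p ^ n
  inBad-rare v y = tail-bound y r 0<r n (λ u → A u v) (l * g v) Λ (s₂ v) (begin
    in′ A v ≤⟨ in≤ v ⟩
    g v * d ≤⟨ *-monoʳ-≤ (g v) d≤ ⟩
    g v * (p * (r * l)) ≡⟨ l₁ (g v) p r l ⟩
    p * (r * (l * g v)) ∎) refl
    where
    open ≤-Reasoning
    l₁ : ∀ a b c d → a * (b * (c * d)) ≡ b * (c * (d * a))
    l₁ = solve-∀

  total-B : ∀ v → 2 ^ Λ * total n (λ c → 𝟙 (B v c)) ≤ p * (2 * p ^ n)
  total-B v = begin
    2 ^ Λ * total n (λ c → 𝟙 (B v c)) ≤⟨ *-monoʳ-≤ (2 ^ Λ) (total-mono n pt) ⟩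
    2 ^ Λ * total n (λ c → sumFin (λ y → o y c + i y c)) ≡⟨ cong (2 ^ Λ *_) (total-sum n (λ y c → o y c + i y c)) ⟩
    2 ^ Λ * sumFin (λ y → total n (λ c → o y c + i y c)) ≡⟨ sum-*ˡ (2 ^ Λ) (λ y → total n (λ c → o y c + i y c)) ⟨
    sumFin (λ y → 2 ^ Λ * total n (λ c → o y c + i y c)) ≤⟨ sum-mono both ⟩
    sumFin {p} (λ y → 2 * p ^ n) ≡⟨ sum-const p (2 * p ^ n) ⟩
    p * (2 * p ^ n) ∎
    where
    open ≤-Reasoning
    o i : Fin p → Vec (Fin p) n → ℕ
    o y c = 𝟙 (outBad v y c)
    i y c = 𝟙 (inBad v y c)
    pt : ∀ c → 𝟙 (B v c) ≤ sumFin (λ y → o y c + i y c)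
    pt c = ≤-trans (anyᵇ-sum (λ y → outBad v y c ∨ inBad v y c)) (sum-mono (λ y → 𝟙-∨ (outBad v y c) (inBad v y c)))
    both : ∀ y → 2 ^ Λ * total n (λ c → o y c + i y c) ≤ 2 * p ^ n
    both y = begin
      2 ^ Λ * total n (λ c → o y c + i y c) ≡⟨ cong (2 ^ Λ *_) (total-+ n (o y) (i y)) ⟩
      2 ^ Λ * (total n (o y) + total n (i y)) ≡⟨ *-distribˡ-+ (2 ^ Λ) (total n (o y)) (total n (i y)) ⟩
      2 ^ Λ * total n (o y) + 2 ^ Λ * total n (i y) ≤⟨ +-mono-≤ (outBad-rare v y) (inBad-rare v y) ⟩
      p ^ n + p ^ n ≡⟨ cong (p ^ n +_) (sym (+-identityʳ (p ^ n))) ⟩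
      2 * p ^ n ∎

  rare : ∀ v → 4 * D * total n (λ c → 𝟙 (B v c)) ≤ p ^ n
  rare v = *-cancelˡ-≤ (2 * p) {{>-nonZero (*-mono-≤ {1} {2} (s≤s z≤n) 0<p)}} (begin
    2 * p * (4 * D * X) ≡⟨ l₁ p D X ⟩
    8 * D * p * X ≤⟨ *-monoˡ-≤ X small ⟩
    2 ^ Λ * X ≤⟨ total-B v ⟩
    p * (2 * p ^ n) ≡⟨ l₂ p (p ^ n) ⟩
    2 * p * p ^ n ∎)
    where
    open ≤-Reasoning
    X = total n (λ c → 𝟙 (B v c))
    l₁ : ∀ p D X → 2 * p * (4 * D * X) ≡ 8 * D * p * X
    l₁ = solve-∀
    l₂ : ∀ p X → p * (2 * X) ≡ 2 * p * X
    l₂ = solve-∀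

  open LocalLemma 0<p B supp dep D (*-mono-≤ 0<K 0<K) rare

  supp-row : ∀ v → sumFin (λ k → 𝟙 (supp v k)) ≤ K
  supp-row v = begin
    sumFin (λ k → 𝟙 (supp v k)) ≤⟨ sum-mono (λ k → 𝟙-∨ (A v k) (A k v)) ⟩
    sumFin (λ k → 𝟙 (A v k) + 𝟙 (A k v)) ≡⟨ sum-+ (λ k → 𝟙 (A v k)) (λ k → 𝟙 (A k v)) ⟩
    out A v + in′ A v ≤⟨ deg≤ v ⟩
    K ∎
    where open ≤-Reasoning

  supp-column : ∀ k → sumFin (λ v → 𝟙 (supp v k)) ≤ K
  supp-column k = begin
    sumFin (λ v → 𝟙 (supp v k)) ≤⟨ sum-mono (λ v → 𝟙-∨ (A v k) (A k v)) ⟩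
    sumFin (λ v → 𝟙 (A v k) + 𝟙 (A k v)) ≡⟨ sum-+ (λ v → 𝟙 (A v k)) (λ v → 𝟙 (A k v)) ⟩
    in′ A k + out A k ≡⟨ +-comm (in′ A k) (out A k) ⟩
    out A k + in′ A k ≤⟨ deg≤ k ⟩
    K ∎
    where open ≤-Reasoning

  sparse : Sparse (allFin n)
  sparse v = begin
    nearSum v (λ _ → 1) (allFin n) ≡⟨ sumList-allFin (λ j → 𝟙 (meets v j) * 1) ⟩
    sumFin (λ j → 𝟙 (meets v j) * 1) ≤⟨ sum-mono pt ⟩
    sumFin (λ j → sumFin (λ k → 𝟙 (supp v k) * 𝟙 (supp j k))) ≡⟨ sum-swap (λ j k → 𝟙 (supp v k) * 𝟙 (supp j k)) ⟩
    sumFin (λ k → sumFin (λ j → 𝟙 (supp v k) * 𝟙 (supp j k))) ≡⟨ sum-cong (λ k → sum-*ˡ (𝟙 (supp v k)) (λ j → 𝟙 (supp j k))) ⟩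
    sumFin (λ k → 𝟙 (supp v k) * sumFin (λ j → 𝟙 (supp j k))) ≤⟨ sum-mono (λ k → *-monoʳ-≤ (𝟙 (supp v k)) (supp-column k)) ⟩
    sumFin (λ k → 𝟙 (supp v k) * K) ≡⟨ sum-*ʳ K (λ k → 𝟙 (supp v k)) ⟩
    sumFin (λ k → 𝟙 (supp v k)) * K ≤⟨ *-monoˡ-≤ K (supp-row v) ⟩
    K * K ∎
    where
    open ≤-Reasoning
    pt : ∀ j → 𝟙 (meets v j) * 1 ≤ sumFin (λ k → 𝟙 (supp v k) * 𝟙 (supp j k))
    pt j = ≤-trans (≤-reflexive (*-identityʳ (𝟙 (meets v j)))) (meets-sum v j)

  below : ∀ {y T s c m} → exceeds y T s c ≡ false → s ≤ m → Tail.hits y q (s≤s z≤n) T c ≤ m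
  below {y} {T} {s} {c} e s≤m = ≤-trans (≰⇒≥ (λ le → true≢false (dec-true (s ≤? Tail.hits y q (s≤s z≤n) T c) le) e)) s≤m

  s₁≤S : s₁ ≤ S
  s₁≤S = ≤-trans (≤-reflexive (sym (*-distribˡ-+ q l Λ))) S≥

  s₂≤S : ∀ v → s₂ v ≤ S * g v
  s₂≤S v = begin
    q * (l * g v) + q * Λ ≤⟨ +-monoʳ-≤ (q * (l * g v)) (*-monoʳ-≤ q (≤-trans (≤-reflexive (sym (*-identityʳ Λ))) (*-monoʳ-≤ Λ (1≤g v)))) ⟩
    q * (l * g v) + q * (Λ * g v) ≡⟨ l₁ q l Λ (g v) ⟩
    q * (l + Λ) * g v ≤⟨ *-monoˡ-≤ (g v) S≥ ⟩
    S * g v ∎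
    where
    open ≤-Reasoning
    l₁ : ∀ q l L g → q * (l * g) + q * (L * g) ≡ q * (l + L) * g
    l₁ = solve-∀

  Spread : (Fin n → Fin p) → Set
  Spread c = (∀ u y → sumFin (λ v → 𝟙 (A u v ∧ eqᵇ (c v) y)) ≤ S) ×
             (∀ v x → sumFin (λ u → 𝟙 (A u v ∧ eqᵇ (c u) x)) ≤ S * g v)

  spread : ∀ c → (∀ v → B v c ≡ false) → Spread (lookup c)
  spread c avoids =
    (λ u y → below {y} {A u} {s₁} {c} (∨-falseˡ (anyᵇ-false (avoids u) y)) s₁≤S) ,
    (λ v x → below {x} {λ u → A u v} {s₂ v} {c} (∨-falseʳ {outBad v x c} (anyᵇ-false (avoids v) x)) (s₂≤S v))

  colouring : Σ (Fin n → Fin p) Spread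
  colouring = finish (avoid (allFin n) sparse)
    where
    finish : (∃ λ c → ∀ v → v ∈ allFin n → B v c ≡ false) → Σ (Fin n → Fin p) Spread
    finish (c , avoids) = lookup c , spread c (λ v → avoids v (∈-allFin v))

-- Choice of parameters

max-∋ : ∀ {n} (g : Fin n → ℕ) i → g i ≤ maxFin g
max-∋ g zero = m≤m⊔n _ _
max-∋ g (suc i) = ≤-trans (max-∋ (g ∘ suc) i) (m≤n⊔m (g zero) _)

ceilDiv-bound : ∀ a b d → 1 ≤ b → ceilDiv a b ≤ d → a ≤ b * d
ceilDiv-bound a (suc b) d _ le = +-cancelʳ-≤ b a _ (begin
  a + b ≡⟨ m≡m%n+[m/n]*n (a + b) (suc b) ⟩
  (a + b) % suc b + (a + b) / suc b * suc b ≤⟨ +-mono-≤ (≤-pred (m%n<n (a + b) (suc b))) (*-monoˡ-≤ (suc b) le) ⟩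
  b + d * suc b ≡⟨ trans (+-comm b _) (cong (_+ b) (*-comm d (suc b))) ⟩
  suc b * d + b ∎)
  where open ≤-Reasoning

degree-bound : ∀ {n} (G : Graph n) f {d} → (∀ v → 2 ≤ f v) → Δf G f ≤ d → ∀ v → degree G v ≤ f v * d
degree-bound G f {d} 2≤f le v = ceilDiv-bound (degree G v) (f v) d (≤-trans (s≤s z≤n) (2≤f v))
  (≤-trans (max-∋ (λ v → ceilDiv (degree G v) (f v)) v) le)

BalancedOrientation : ∀ {n} → Graph n → (Fin n → ℕ) → ℕ → Set
BalancedOrientation {n} G g d =
  Σ (Digraph n) λ o → Orients (adj G) o × (∀ v → in′ o v ≤ g v * d) × (∀ v → out o v ≤ d)

-- The forest orientation shows that every `R` spans at most `d` edges per vertex, and `d ≤ α v`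
-- because `f v ≥ 2`; this is the sparsity needed. The degree condition is `f v * d = α v + d`.
balanced-orientation : ∀ {n} (G : Graph n) f {a d} → (∀ v → 2 ≤ f v) → Δf G f ≤ d → a ≤ d →
  ForestColourable G a → BalancedOrientation G (λ v → f v ∸ 1) d
balanced-orientation {n} G f {a} {d} 2≤f Δ≤d a≤d fc = from (arboricity-orientation G fc)
  where
  α : Fin n → ℕ
  α v = (f v ∸ 1) * d
  d≤α : ∀ v → d ≤ α v
  d≤α v = ≤-trans (≤-reflexive (sym (*-identityˡ d))) (*-monoˡ-≤ d (∸-monoˡ-≤ 1 (2≤f v)))
  deg≤ : ∀ v → degree G v ≤ α v + d
  deg≤ v = ≤-trans (degree-bound G f 2≤f Δ≤d v) (≤-reflexive (begin
    f v * d ≡⟨ cong (_* d) (m∸n+n≡m (≤-trans (s≤s z≤n) (2≤f v))) ⟨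
    (f v ∸ 1 + 1) * d ≡⟨ *-distribʳ-+ d (f v ∸ 1) 1 ⟩
    α v + 1 * d ≡⟨ cong (α v +_) (*-identityˡ d) ⟩
    α v + d ∎))
    where open ≡-Reasoning
  from : (Σ (Digraph n) λ o → Orients (adj G) o × (∀ v → out o v ≤ a)) → BalancedOrientation G (λ v → f v ∸ 1) d
  from (o , s , out≤) = reorientation (adj G) α (λ _ → d) sparse deg≤ o s (λ v → ≤-trans (out≤ v) a≤d)
    where
    sparse : ∀ R → inside (adj G) R ≤ 2 * sumFin (λ w → 𝟙 (R w) * α w)
    sparse R = begin
      inside (adj G) R ≡⟨ inside-orient R (Orients-flip s) ⟩
      2 * inside (flip o) R ≤⟨ *-monoʳ-≤ 2 (inside-≤-in (flip o) R) ⟩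
      2 * sumFin (λ w → 𝟙 (R w) * out o w) ≤⟨ *-monoʳ-≤ 2 (sum-mono (λ w → *-monoʳ-≤ (𝟙 (R w)) (≤-trans (≤-trans (out≤ w) a≤d) (d≤α w)))) ⟩
      2 * sumFin (λ w → 𝟙 (R w) * α w) ∎
      where open ≤-Reasoning

orient-irrefl : ∀ {n} (G : Graph n) {o} → Orients (adj G) o → ∀ v → o v v ≡ false
orient-irrefl G {o} s v with o v v in e
... | false = refl
... | true = ⊥-elim (true≢false e (orient-antisym s e))

colour-with : ∀ {n p} (G : Graph n) f {d} → (∀ v → 2 ≤ f v) → (o : BalancedOrientation G (λ v → f v ∸ 1) d) →
  ∀ k (c : Fin n → Fin p) →
  (∀ u y → sumFin (λ v → 𝟙 (proj₁ o u v ∧ eqᵇ (c v) y)) ≤ 2 ^ k) →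
  (∀ v x → sumFin (λ u → 𝟙 (proj₁ o u v ∧ eqᵇ (c u) x)) ≤ 2 ^ k * (f v ∸ 1)) →
  FForestColourable G f ((3 + p) * 2 ^ k)
colour-with {p = p} G f 2≤f (o , s , _ , _) k c out≤ in≤ =
  to-colouring G f 2≤f (*-mono-≤ {1} {3 + p} (s≤s z≤n) (m^n>0 2 k)) o s
    (ColourDecompose.decomposition o (orient-irrefl G s) c (λ v → f v ∸ 1) k out≤ in≤)

power-between : ∀ x → 1 ≤ x → ∃ λ k → x ≤ 2 ^ k × 2 ^ k ≤ 2 * x
power-between (suc zero) _ = 0 , ≤-refl , s≤s z≤n
power-between (suc x@(suc _)) _ with power-between x (s≤s z≤n)
... | k , lo , hi with suc x ≤? 2 ^ k
...   | yes l = k , l , ≤-trans hi (*-monoʳ-≤ 2 (n≤1+n x))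
...   | no ¬l = suc k , ≤-trans (≤-trans (≤-reflexive (+-comm 1 x)) (≤-trans (+-monoʳ-≤ x (s≤s z≤n)) (≤-reflexive (cong (x +_) (sym (+-identityʳ x)))))) (*-monoʳ-≤ 2 lo)
                    , *-monoʳ-≤ 2 (<⇒≤ (≰⇒> ¬l))

n<2^n : ∀ n → n < 2 ^ n
n<2^n zero = s≤s z≤n
n<2^n (suc n) = begin-strict
  suc n <⟨ s≤s (n<2^n n) ⟩
  1 + 2 ^ n ≤⟨ +-mono-≤ (m^n>0 2 n) (m≤m+n (2 ^ n) 0) ⟩
  2 ^ suc n ∎
  where open ≤-Reasoning

n<2^1+log : ∀ n → n < 2 ^ suc ⌊log₂ n ⌋
n<2^1+log n = ≰⇒> λ le → n≮n ⌊log₂ n ⌋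
  (≤-trans (≤-reflexive (sym (⌊log₂[2^n]⌋≡n (suc ⌊log₂ n ⌋)))) (⌊log₂⌋-mono-≤ le))

-- Powers of 16 because `r = 2 ^ j` has `r ^ 4 = 16 ^ j`: this locates `r` with r⁴X within a factor
-- 16 of `d`.
scale : ∀ X d → 1 ≤ X → X ≤ d → ∃ λ j → 16 ^ j * X ≤ d × d < 16 ^ suc j * X
scale X d 1≤X X≤d = go d (begin-strict
  d <⟨ n<2^n d ⟩
  2 ^ d ≤⟨ ^-monoˡ-≤ d (m≤m+n 2 14) ⟩
  16 ^ d ≡⟨ *-identityʳ (16 ^ d) ⟨
  16 ^ d * 1 ≤⟨ *-monoʳ-≤ (16 ^ d) 1≤X ⟩
  16 ^ d * X ∎)
  where
  open ≤-Reasoning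
  go : ∀ k → d < 16 ^ k * X → ∃ λ j → 16 ^ j * X ≤ d × d < 16 ^ suc j * X
  go zero l = contradiction (≤-trans X≤d (≤-refl)) (<⇒≱ (≤-trans l (≤-reflexive (*-identityˡ X))))
  go (suc k) l with 16 ^ k * X ≤? d
  ... | yes le = k , le , l
  ... | no ¬le = go k (≰⇒> ¬le)

ceil-quotient : ∀ d m → 1 ≤ d → 1 ≤ m → ∃ λ p → 1 ≤ p × p ≤ d × d ≤ p * m × p * m ≤ d + m
ceil-quotient (suc d) (suc m) _ _ =
  suc (d / suc m) , s≤s z≤n , s≤s (m/n≤m d (suc m)) ,
  ≤-trans (≤-reflexive (cong suc (m≡m%n+[m/n]*n d (suc m)))) (+-monoˡ-≤ (d / suc m * suc m) (m%n<n d (suc m))) ,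
  ≤-trans (≤-reflexive (+-comm (suc m) _)) (+-monoˡ-≤ (suc m) (≤-trans (m/n*n≤m d (suc m)) (n≤1+n d)))

fourth : ∀ {m n} → m ≤ n → m ^ 4 ≤ n ^ 4
fourth = ^-monoˡ-≤ 4

-- For M = Λ² the conclusion is E = O(d^(3/4) Λ^(1/2)) in fourth powers: one of the four factors `d`
-- is traded for `w * M`.
crude-bound : ∀ {u w C} E d M → u ^ 4 * w ≤ C → E ≤ u * d → d ≤ w * M → E ^ 4 ≤ C * d ^ 3 * M
crude-bound {u} {w} {C} E d M C≥ E≤ d≤ = begin
  E ^ 4 ≤⟨ fourth E≤ ⟩
  (u * d) ^ 4 ≡⟨ ^-distribʳ-* 4 u d ⟩
  u ^ 4 * (d * d ^ 3) ≤⟨ *-monoʳ-≤ (u ^ 4) (*-monoˡ-≤ (d ^ 3) d≤) ⟩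
  u ^ 4 * (w * M * d ^ 3) ≡⟨ l (u ^ 4) w M (d ^ 3) ⟩
  u ^ 4 * w * d ^ 3 * M ≤⟨ *-monoˡ-≤ M (*-monoˡ-≤ (d ^ 3) C≥) ⟩
  C * d ^ 3 * M ∎
  where
  open ≤-Reasoning
  l : ∀ a b M D → a * (b * M * D) ≡ a * b * D * M
  l = solve-∀

fine-bound : ∀ {u w C} r E d M → u ^ 4 * w ≤ C → 0 < r → r * E ≤ u * d → d ≤ w * r ^ 4 * M →
  E ^ 4 ≤ C * d ^ 3 * M
fine-bound {u} {w} {C} r E d M C≥ 0<r rE≤ d≤ =
  *-cancelˡ-≤ (r ^ 4) {{>-nonZero (m^n>0 r {{>-nonZero 0<r}} 4)}} (begin
    r ^ 4 * E ^ 4 ≡⟨ ^-distribʳ-* 4 r E ⟨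
    (r * E) ^ 4 ≤⟨ crude-bound {u} {w} (r * E) d (r ^ 4 * M) C≥ rE≤ (≤-trans d≤ (≤-reflexive (*-assoc w (r ^ 4) M))) ⟩
    C * d ^ 3 * (r ^ 4 * M) ≡⟨ l (C * d ^ 3) (r ^ 4) M ⟩
    r ^ 4 * (C * d ^ 3 * M) ∎)
  where
  open ≤-Reasoning
  l : ∀ a R M → a * (R * M) ≡ R * (a * M)
  l = solve-∀

const-bound : ∀ c u b → c ≡ u ^ 4 → c * (b * b) ≤ (u * b) ^ 4
const-bound _ u zero refl = ≤-trans (≤-reflexive (*-zeroʳ (u ^ 4))) z≤n
const-bound _ u b@(suc _) refl = begin
  u ^ 4 * (b * b) ≤⟨ *-monoʳ-≤ (u ^ 4) (*-monoʳ-≤ b (≤-trans (≤-reflexive (sym (*-identityʳ b))) (*-monoʳ-≤ b (m^n>0 b 2)))) ⟩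
  u ^ 4 * b ^ 4 ≡⟨ ^-distribʳ-* 4 u b ⟨
  (u * b) ^ 4 ∎
  where open ≤-Reasoning

-- Abstract, because the type checker would unfold products with these numerals.
abstract
  W C : ℕ
  -- `16 ^ 2`, so that `d ≤ W * M` covers the scales `j = 0` and `j = 1`. The resulting `C` also
  -- exceeds `12 ^ 4 * 16`, the constant of the fine case.
  W = 256
  C = 8 ^ 4 * W

  leadingConstant : ℕ → ℕ
  -- `64 ^ 4 = C * 16`, where 16 is the square of the 4 in `Λ′ ≤ 4 * b * ℓ`.
  leadingConstant b = 64 * b

  16≤W : 16 ^ 1 ≤ W
  16≤W = m≤m+n 16 240

  16²≤W : 16 ^ 2 ≤ W
  16²≤W = ≤-refl

  1≤W : 1 ≤ W
  1≤W = s≤s z≤n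

  C-crude : 8 ^ 4 * W ≤ C
  C-crude = ≤-refl

  C-fine : 12 ^ 4 * 16 ≤ C
  C-fine = ≤ᵇ⇒≤ (12 ^ 4 * 16) C tt

  leadingConstant-pos : ∀ b → 0 < b → 0 < leadingConstant b
  leadingConstant-pos b 0<b = *-mono-≤ {1} {64} (s≤s z≤n) 0<b

  leadingConstant-bound : ∀ b → C * 16 * (b * b) ≤ leadingConstant b ^ 4
  leadingConstant-bound b = const-bound (C * 16) 64 b refl

module LargeDegree {n} (G : Graph n) (f : Fin n → ℕ) (t d : ℕ) (2≤d : 2 ≤ d) (1≤t : 1 ≤ t)
  (2≤f : ∀ v → 2 ≤ f v) (f≤t : ∀ v → f v ≤ t) (Δ≤d : Δf G f ≤ d)
  (o : BalancedOrientation G (λ v → f v ∸ 1) d) where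

  -- Chosen for `small`: 8 (td)² p is at most 2 to the power 3 + 2t + 3(ℓ + 1), and this exponent is
  -- at most (6 + 2t)(ℓ + 1).
  b ℓ : ℕ
  b = 6 + 2 * t
  ℓ = ⌊log₂ d ⌋

  1≤d : 1 ≤ d
  1≤d = ≤-trans (s≤s z≤n) 2≤d

  1≤ℓ : 1 ≤ ℓ
  1≤ℓ = ≤-trans (≤-reflexive (sym (⌊log₂[2^n]⌋≡n 1))) (⌊log₂⌋-mono-≤ 2≤d)

  Within : ℕ → Set
  Within M = ∃ λ k → FForestColourable G f k × (k ∸ d) ^ 4 ≤ C * d ^ 3 * M

  -- A single vertex colour already gives 4 · 2^k ≤ 8 d forests.
  crude : ∀ M → d ≤ W * M → Within M
  crude M d≤ with power-between d 1≤d
  ... | k , lo , hi = 4 * 2 ^ k ,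
    colour-with G f 2≤f o k (λ _ → zero {0})
      (λ u y → ≤-trans (sum-mono (λ v → 𝟙-mono {A u v ∧ eqᵇ zero y} ∧-trueˡ)) (≤-trans (proj₂ (proj₂ (proj₂ o)) u) lo))
      (λ v x → ≤-trans (sum-mono (λ u → 𝟙-mono {A u v ∧ eqᵇ zero x} ∧-trueˡ)) (≤-trans (proj₁ (proj₂ (proj₂ o)) v)
        (≤-trans (≤-reflexive (*-comm (f v ∸ 1) d)) (*-monoˡ-≤ (f v ∸ 1) lo)))) ,
    crude-bound {8} {W} _ d M C-crude (≤-trans (m∸n≤m (4 * 2 ^ k) d) (≤-trans (*-monoʳ-≤ 4 hi) (≤-reflexive (l d)))) d≤
    where
    A = proj₁ o
    l : ∀ d → 4 * (2 * d) ≡ 8 * d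
    l = solve-∀

  module _ (λ′ : ℕ) (Λ≥ : b * suc ℓ ≤ 2 ^ λ′) where
    Λ : ℕ
    Λ = 2 ^ λ′

    small : ∀ p → p ≤ d → 8 * (t * d * (t * d)) * p ≤ 2 ^ Λ
    small p p≤d = begin
      8 * (t * d * (t * d)) * p ≤⟨ *-mono-≤ (*-monoʳ-≤ 8 (*-mono-≤ td td)) p≤ ⟩
      2 ^ 3 * (2 ^ t * 2 ^ L * (2 ^ t * 2 ^ L)) * 2 ^ L ≡⟨ l (2 ^ 3) (2 ^ t) (2 ^ L) ⟩
      2 ^ 3 * (2 ^ t * 2 ^ t) * (2 ^ L * (2 ^ L * 2 ^ L)) ≡⟨ cong₂ (λ y z → 2 ^ 3 * y * z) (sym (^-distribˡ-+-* 2 t t))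
          (sym (trans (^-distribˡ-+-* 2 L (L + L)) (cong (2 ^ L *_) (^-distribˡ-+-* 2 L L)))) ⟩
      2 ^ 3 * 2 ^ (t + t) * 2 ^ (L + (L + L)) ≡⟨ cong (_* 2 ^ (L + (L + L))) (sym (^-distribˡ-+-* 2 3 (t + t))) ⟩
      2 ^ (3 + (t + t)) * 2 ^ (L + (L + L)) ≡⟨ ^-distribˡ-+-* 2 (3 + (t + t)) (L + (L + L)) ⟨
      2 ^ (3 + (t + t) + (L + (L + L))) ≤⟨ ^-monoʳ-≤ 2 (≤-trans (≤-trans (m≤m+n (3 + (t + t) + (L + (L + L))) ((3 + (t + t)) * ℓ)) (≤-reflexive (l′ t ℓ))) Λ≥) ⟩
      2 ^ Λ ∎
      where
      open ≤-Reasoning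
      L = suc ℓ
      p≤ : p ≤ 2 ^ L
      p≤ = ≤-trans p≤d (<⇒≤ (n<2^1+log d))
      td : t * d ≤ 2 ^ t * 2 ^ L
      td = *-mono-≤ (<⇒≤ (n<2^n t)) (<⇒≤ (n<2^1+log d))
      l : ∀ a b c → a * (b * c * (b * c)) * c ≡ a * (b * b) * (c * (c * c))
      l = solve-∀
      l′ : ∀ t ℓ → 3 + (t + t) + (suc ℓ + (suc ℓ + suc ℓ)) + (3 + (t + t)) * ℓ ≡ (6 + 2 * t) * suc ℓ
      l′ = solve-∀

    -- With r = 2^j = w + 2, S = r²Λ ≈ √d and l′ = (r − 2)Λ one has (r + 1)(l′ + Λ) ≤ S = r l′ + 2rΛ.
    fine : ∀ j w → 2 ≤ w → 2 ^ j ≡ 2 + w → 16 ^ j * (Λ * Λ) ≤ d → d ≤ 16 ^ suc j * (Λ * Λ) → Within (Λ * Λ)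
    fine j w 2≤w 2^j≡r lo hi = from (ceil-quotient d m 1≤d 1≤m)
      where
      open ≤-Reasoning
      r l′ m S k : ℕ
      r = 2 + w
      l′ = w * Λ
      m = r * l′
      S = r * r * Λ
      k = j + j + λ′
      S≡ : S ≡ 2 ^ k
      S≡ = trans (cong (λ z → z * z * Λ) (sym 2^j≡r))
                 (sym (trans (^-distribˡ-+-* 2 (j + j) λ′) (cong (_* Λ) (^-distribˡ-+-* 2 j j))))
      1≤Λ : 1 ≤ Λ
      1≤Λ = m^n>0 2 λ′
      1≤m : 1 ≤ m
      1≤m = *-mono-≤ {1} {r} (s≤s z≤n) (*-mono-≤ (≤-trans (s≤s z≤n) 2≤w) 1≤Λ)
      16^j : 16 ^ j ≡ r ^ 4
      16^j = trans (^-*-assoc 2 4 j) (trans (cong (2 ^_) (*-comm 4 j)) (trans (sym (^-*-assoc 2 j 4)) (cong (_^ 4) 2^j≡r)))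
      r⁴Λ²≤d : r ^ 4 * (Λ * Λ) ≤ d
      r⁴Λ²≤d = ≤-trans (≤-reflexive (cong (_* (Λ * Λ)) (sym 16^j))) lo
      S² : S * S ≡ r ^ 4 * (Λ * Λ)
      S² = e r Λ
        where
        e : ∀ r L → r * r * L * (r * r * L) ≡ r * (r * (r * (r * 1))) * (L * L)
        e = solve-∀
      1≤S : 1 ≤ S
      1≤S = *-mono-≤ {1} {r * r} (s≤s z≤n) 1≤Λ
      -- Since l′ + Λ = (r - 1)Λ and (r + 1)(r - 1) = r² - 1, exactly one `Λ` is left over.
      S≥ : suc r * (l′ + Λ) ≤ S
      S≥ = ≤-trans (m≤m+n _ Λ) (≤-reflexive (e w Λ))
        where
        e : ∀ w L → suc (2 + w) * (w * L + L) + L ≡ (2 + w) * (2 + w) * L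
        e = solve-∀
      S-m : S ≡ m + 2 * (r * Λ)
      S-m = e w Λ
        where
        e : ∀ w L → (2 + w) * (2 + w) * L ≡ (2 + w) * (w * L) + 2 * ((2 + w) * L)
        e = solve-∀
      m≤S : m ≤ S
      m≤S = ≤-trans (m≤m+n m _) (≤-reflexive (sym S-m))
      S≤2m : S ≤ 2 * m
      S≤2m = begin
        r * r * Λ ≤⟨ *-monoˡ-≤ Λ (*-monoʳ-≤ r (+-monoˡ-≤ w 2≤w)) ⟩
        r * (w + w) * Λ ≡⟨ e r w Λ ⟩
        2 * m ∎
        where
        e : ∀ r w L → r * (w + w) * L ≡ 2 * (r * (w * L))
        e = solve-∀
      S²≤d : S * S ≤ d
      S²≤d = ≤-trans (≤-reflexive S²) r⁴Λ²≤d
      m≤d : m ≤ d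
      m≤d = ≤-trans m≤S (≤-trans (≤-trans (≤-reflexive (sym (*-identityʳ S))) (*-monoʳ-≤ S 1≤S)) S²≤d)
      rS≤d : r * S ≤ d
      rS≤d = begin
        r * S ≤⟨ *-monoˡ-≤ S (≤-trans (≤-trans (≤-reflexive (sym (*-identityʳ r))) (*-monoʳ-≤ r {1} {r} (s≤s z≤n))) (≤-trans (≤-reflexive (sym (*-identityʳ (r * r)))) (*-monoʳ-≤ (r * r) 1≤Λ))) ⟩
        S * S ≤⟨ S²≤d ⟩
        d ∎
      from : (∃ λ p → 1 ≤ p × p ≤ d × d ≤ p * m × p * m ≤ d + m) → Within (Λ * Λ)
      from (p , 1≤p , p≤d , d≤pm , pm≤) =
        (3 + p) * S , subst (λ z → FForestColourable G f ((3 + p) * z)) (sym S≡) (coloured RC.colouring) ,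
        fine-bound {12} {16} r ((3 + p) * S ∸ d) d (Λ * Λ) C-fine (s≤s z≤n) excess (≤-trans hi (≤-reflexive (cong (λ z → 16 * z * (Λ * Λ)) 16^j)))
        where
        A = proj₁ o
        deg≤ : ∀ v → out A v + in′ A v ≤ t * d
        deg≤ v = ≤-trans (≤-reflexive (sym (deg-orient (proj₁ (proj₂ o)) v)))
          (≤-trans (degree-bound G f 2≤f Δ≤d v) (*-monoˡ-≤ d (f≤t v)))
        module RC = RandomColouring A (λ v → f v ∸ 1) (λ v → ∸-monoˡ-≤ 1 (2≤f v)) d (t * d) p r l′ Λ S
          1≤p (s≤s z≤n) (*-mono-≤ 1≤t 1≤d) (proj₂ (proj₂ (proj₂ o))) (proj₁ (proj₂ (proj₂ o))) deg≤ d≤pm S≥ (small p p≤d)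
        coloured : Σ (Fin n → Fin p) RC.Spread → FForestColourable G f ((3 + p) * 2 ^ k)
        coloured (c , out≤ , in≤) = colour-with G f 2≤f o k c
          (λ u y → ≤-trans (out≤ u y) (≤-reflexive S≡))
          (λ v x → ≤-trans (in≤ v x) (≤-reflexive (cong (_* (f v ∸ 1)) S≡)))
        pS≤4d : p * S ≤ 4 * d
        pS≤4d = begin
          p * S ≤⟨ *-monoʳ-≤ p S≤2m ⟩
          p * (2 * m) ≡⟨ e p m ⟩
          2 * (p * m) ≤⟨ *-monoʳ-≤ 2 (≤-trans pm≤ (+-monoʳ-≤ d m≤d)) ⟩
          2 * (d + d) ≡⟨ e′ d ⟩
          4 * d ∎
          where
          e : ∀ p m → p * (2 * m) ≡ 2 * (p * m)
          e = solve-∀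
          e′ : ∀ d → 2 * (d + d) ≡ 4 * d
          e′ = solve-∀
        -- `4 * S` covers the three extra classes and the rounding of `p`; the other term is the
        -- concentration loss p (S - m).
        X = 4 * S + 2 * (p * (r * Λ))
        total≤ : (3 + p) * S ≤ d + X
        total≤ = begin
          (3 + p) * S ≡⟨ *-distribʳ-+ S 3 p ⟩
          3 * S + p * S ≡⟨ cong (λ z → 3 * S + p * z) S-m ⟩
          3 * S + p * (m + 2 * (r * Λ)) ≡⟨ e S p m (r * Λ) ⟩
          p * m + (3 * S + 2 * (p * (r * Λ))) ≤⟨ +-monoˡ-≤ _ (≤-trans pm≤ (+-monoʳ-≤ d m≤S)) ⟩
          d + S + (3 * S + 2 * (p * (r * Λ))) ≡⟨ e′ d S (2 * (p * (r * Λ))) ⟩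
          d + X ∎
          where
          e : ∀ S p m y → 3 * S + p * (m + 2 * y) ≡ p * m + (3 * S + 2 * (p * y))
          e = solve-∀
          e′ : ∀ d S y → d + S + (3 * S + y) ≡ d + (4 * S + y)
          e′ = solve-∀
        -- Multiplied by `r`, the loss becomes 4rS + 2pS; here rS ≤ S² ≤ d and pS ≤ 4d, whence 12.
        excess : r * ((3 + p) * S ∸ d) ≤ 12 * d
        excess = begin
          r * ((3 + p) * S ∸ d) ≤⟨ *-monoʳ-≤ r (≤-trans (∸-monoˡ-≤ d total≤) (≤-reflexive (m+n∸m≡n d X))) ⟩
          r * X ≡⟨ e r S p Λ ⟩
          4 * (r * S) + 2 * (p * S) ≤⟨ +-mono-≤ (*-monoʳ-≤ 4 rS≤d) (*-monoʳ-≤ 2 pS≤4d) ⟩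
          4 * d + 2 * (4 * d) ≡⟨ e′ d ⟩
          12 * d ∎
          where
          e : ∀ r S p L → r * (4 * S + 2 * (p * (r * L))) ≡ 4 * (r * S) + 2 * (p * (r * r * L))
          e = solve-∀
          e′ : ∀ d → 4 * d + 2 * (4 * d) ≡ 12 * d
          e′ = solve-∀

    within : Within (Λ * Λ)
    within with Λ * Λ ≤? d
    ... | no ¬le = crude (Λ * Λ) (≤-trans (<⇒≤ (≰⇒> ¬le)) (≤-trans (≤-reflexive (sym (*-identityˡ (Λ * Λ)))) (*-monoˡ-≤ (Λ * Λ) 1≤W)))
    ... | yes le with scale (Λ * Λ) d (*-mono-≤ (m^n>0 2 λ′) (m^n>0 2 λ′)) le
    ...   | zero , _ , hi = crude (Λ * Λ) (≤-trans (<⇒≤ hi) (*-monoˡ-≤ (Λ * Λ) 16≤W))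
    ...   | suc zero , _ , hi = crude (Λ * Λ) (≤-trans (<⇒≤ hi) (*-monoˡ-≤ (Λ * Λ) 16²≤W))
    -- From `j ≥ 2` follows r ≥ 4, that is w = r - 2 ≥ r/2, which keeps `m` at least half of `S`.
    ...   | j@(suc (suc i)) , lo , hi = fine j (2 ^ j ∸ 2) (∸-monoˡ-≤ 2 4≤) (sym (m+[n∸m]≡n (≤-trans (m≤m+n 2 2) 4≤))) lo (<⇒≤ hi)
      where
      4≤ : 4 ≤ 2 ^ j
      4≤ = ^-monoʳ-≤ 2 {2} {j} (s≤s (s≤s z≤n))

  bounded : ∃ λ k → FForestColourable G f k × (k ∸ d) ^ 4 ≤ leadingConstant b ^ 4 * d ^ 3 * ℓ ^ 2
  bounded with power-between (b * suc ℓ) (s≤s z≤n)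
  ... | λ′ , lo , hi with within λ′ lo
  ...   | k , col , le = k , col , (begin
    (k ∸ d) ^ 4 ≤⟨ le ⟩
    C * d ^ 3 * (Λ′ * Λ′) ≤⟨ *-monoʳ-≤ (C * d ^ 3) (*-mono-≤ Λ≤ Λ≤) ⟩
    C * d ^ 3 * (4 * b * ℓ * (4 * b * ℓ)) ≡⟨ e C (d ^ 3) b ℓ ⟩
    C * 16 * (b * b) * d ^ 3 * ℓ ^ 2 ≤⟨ *-monoˡ-≤ (ℓ ^ 2) (*-monoˡ-≤ (d ^ 3) (leadingConstant-bound b)) ⟩
    leadingConstant b ^ 4 * d ^ 3 * ℓ ^ 2 ∎)
    where
    open ≤-Reasoning
    Λ′ = 2 ^ λ′
    -- Rounding to a power of two costs a factor 2, and ℓ + 1 ≤ 2ℓ another, since `d ≥ 2`.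
    Λ≤ : Λ′ ≤ 4 * b * ℓ
    Λ≤ = begin
      Λ′ ≤⟨ hi ⟩
      2 * (b * suc ℓ) ≤⟨ *-monoʳ-≤ 2 (*-monoʳ-≤ b (+-monoˡ-≤ ℓ 1≤ℓ)) ⟩
      2 * (b * (ℓ + ℓ)) ≡⟨ e′ b ℓ ⟩
      4 * b * ℓ ∎
      where
      e′ : ∀ b l → 2 * (b * (l + l)) ≡ 4 * b * l
      e′ = solve-∀
    e : ∀ c D b l → c * D * (4 * b * l * (4 * b * l)) ≡ c * 16 * (b * b) * D * (l * (l * 1))
    e = solve-∀

-- Colour sets are Fin k, so for n ≥ 1 every arboricity is at least 1, even without edges.
small-degree : ∀ {n} (G : Graph n) f d a → d ≤ 1 → a ≤ d → Δf G f ≤ d → (∀ v → 2 ≤ f v) →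
  ForestColourable G a → FForestColourable G f d
small-degree {zero} G f d a _ _ _ _ _ = record { col = λ () ; colSym = λ () } , λ i → (λ c → no-vertex (Cycle.first c)) , λ ()
  where
  no-vertex : Fin 0 → ⊥
  no-vertex ()
small-degree {suc n} G f d a d≤1 a≤d Δ≤d 2≤f fc@(c , forests) with col c zero zero
small-degree {suc n} G f (suc zero) (suc zero) d≤1 a≤d Δ≤d 2≤f (c , forests) | _ =
  c , λ i → forests i , λ v → ≤-trans (sum-mono (λ u → 𝟙-mono {colourClass G c i v u} {adj G v u} ∧-trueˡ))
    (≤-trans (degree-bound G f 2≤f Δ≤d v) (≤-reflexive (*-identityʳ (f v))))
small-degree {suc n} G f (suc (suc d)) (suc a) (s≤s ()) a≤d Δ≤d 2≤f (c , forests) | _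
small-degree {suc n} G f (suc zero) (suc (suc a)) _ (s≤s ()) Δ≤d 2≤f (c , forests) | _

theorem7 : (t : ℕ) → 2 ≤ t →
    Σ ℕ (λ c → 0 < c ×
    ((n : ℕ) (G : Graph n) (f : Fin n → ℕ) →
    (∀ v → 2 ≤ f v × f v ≤ t) →
    (a af : ℕ) → IsArboricity G a → IsFArboricity G f af →
    (af ∸ (Δf G f ⊔ a)) ^ 4 ≤ c ^ 4 * (Δf G f ⊔ a) ^ 3 * ⌊log₂ (Δf G f ⊔ a) ⌋ ^ 2))
theorem7 t 2≤t = leadingConstant (6 + 2 * t) , leadingConstant-pos (6 + 2 * t) (s≤s z≤n) , bound
  where
  bound : (n : ℕ) (G : Graph n) (f : Fin n → ℕ) →
    (∀ v → 2 ≤ f v × f v ≤ t) →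
    (a af : ℕ) → IsArboricity G a → IsFArboricity G f af →
    (af ∸ (Δf G f ⊔ a)) ^ 4 ≤ leadingConstant (6 + 2 * t) ^ 4 * (Δf G f ⊔ a) ^ 3 * ⌊log₂ (Δf G f ⊔ a) ⌋ ^ 2
  bound n G f hf a af (fc , _) (_ , minimal) = go (2 ≤? d)
    where
    d = Δf G f ⊔ a
    Δ≤d : Δf G f ≤ d
    Δ≤d = m≤m⊔n _ a
    a≤d : a ≤ d
    a≤d = m≤n⊔m (Δf G f) a
    2≤f : ∀ v → 2 ≤ f v
    2≤f v = proj₁ (hf v)
    -- Monotone in `k`, so by minimality of `af` it is enough to exhibit some colourable `k` that
    -- satisfies it.
    Bound : ℕ → Set
    Bound k = (k ∸ d) ^ 4 ≤ leadingConstant (6 + 2 * t) ^ 4 * d ^ 3 * ⌊log₂ d ⌋ ^ 2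
    use : (∃ λ k → FForestColourable G f k × Bound k) → Bound af
    use (k , col , le) = ≤-trans (fourth (∸-monoˡ-≤ d (minimal k col))) le
    go : Dec (2 ≤ d) → Bound af
    go (yes 2≤d) = use (LargeDegree.bounded G f t d 2≤d (≤-trans (s≤s z≤n) 2≤t) 2≤f (λ v → proj₂ (hf v)) Δ≤d
      (balanced-orientation G f 2≤f Δ≤d a≤d fc))
    -- For `d ≤ 1` the logarithm is 0 and no error is allowed, so exactly `d` colours must suffice.
    go (no 2≰d) = use (d , small-degree G f d a (≤-pred (≰⇒> 2≰d)) a≤d Δ≤d 2≤f fc ,
      subst (λ z → z ^ 4 ≤ leadingConstant (6 + 2 * t) ^ 4 * d ^ 3 * ⌊log₂ d ⌋ ^ 2) (sym (n∸n≡0 d)) z≤n)
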